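{- Let $s,v,m$ be positive integers and $\epsilon\in\{1,-1\}$, excluding the case where $\epsilon=-1$ and $vm^2\le4$. Put $d=svm/2$, $k=s^2v(vm^2+4\epsilon)/4$, $\xi=d+\sqrt{k}$, and $f_\xi(x)=svm-\dfrac{\epsilon s^2v}{x}$ on $\mathbb{R}\cup\{\infty\}$. Let $\delta_\epsilon=0$ if $\epsilon=1$ and $\delta_\epsilon=1$ if $\epsilon=-1$. Let $v_n=v$ for even $n$ and $v_n=1$ for odd $n$, and let $a_0=0$, $a_1=1$, $a_{n+1}=v_nma_n+\epsilon a_{n-1}$. For $n\ge0$ let $s_n=\gcd(a_n,s)$, let $m_n$ be the unique integer with $0\le m_n<s/s_n$ and $m_n\cdot (a_n/s_n)\equiv -a_{n-1}\pmod{s/s_n}$ (for $n=0$ the modulus is $1$ and $m_0=0$), and let $$\hat\xi_n=\frac{s_nv_nm-\epsilon m_n}{s/s_n}.$$ Let $E_0$ be the finite continued fraction expansion of $\hat\xi_0$, and for $n\ge1$ let $E_n$ be the finite continued fraction expansion of $\hat\xi_n-\delta_\epsilon$, where every $E_n$ is chosen to have an odd number of terms if $\epsilon=1$ and an even number of terms if $\epsilon=-1$. Let $[C]=[c_0,c_1,c_2,\dots]$ be the infinite continued fraction whose sequence of terms is the concatenation $E_0,E_1,E_2,\dots$. Then: (a) the continued fraction $[C]$ converges to $\xi$, i.e. its finite truncations $[c_0,\dots,c_j]$ (evaluated in $\mathbb{R}\cup\{\infty\}$) tend to $\xi$ as $j\to\infty$; (b) for every $n\ge0$, the value of the finite continued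 fraction formed by the concatenation $E_0,\dots,E_{n-1}$ equals $f_\xi^n(\infty)$ (for $n=0$ the empty continued fraction is interpreted as $\infty$).
   Context: Finite continued fractions: $[c_0,c_1,\dots,c_n]=c_0+1/(c_1+1/(\cdots+1/c_n))$, evaluated in $\mathbb{R}\cup\{\infty\}$ with $1/0=\infty$, $1/\infty=0$. Every rational number has exactly two finite continued fraction expansions $[c_0,\dots,c_n]$ with $c_0\in\mathbb{Z}$ and $c_1,\dots,c_n$ positive integers; their lengths differ by one, since $[c_0,\dots,c_{n-1},c_n,1]=[c_0,\dots,c_{n-1},c_n+1]$ (for an integer $p$ they are $[p]$ and $[p-1,1]$). "The expansion with an odd/even number of terms" refers to the one of these two with that length parity. The terms of $[C]$ may include zero or negative values at the start of each block $E_n$. The excluded case $\epsilon=-1$, $vm^2\le4$ is exactly where $\xi$ fails to be real and irrational.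
   Formalization: The formal statement uses f_ξ(x) = svm + εs²v/x instead of svm − εs²v/x; with the printed minus sign (b) fails, e.g. s=v=m=1, ε=1, n=2 gives [1,1]=2 but f_ξ²(∞)=0, and ξ is not a fixed point of the printed f_ξ. -}

module Defs where

open import Data.Nat as ℕ using (ℕ; zero; suc)
import Data.Nat.Base as ℕB
open import Data.Nat.GCD using (gcd)
open import Data.Integer as ℤ using (ℤ; +_; ∣_∣; _/ℕ_)
open import Data.Rational as ℚ using (ℚ; 0ℚ; 1/_; ≢-nonZero)
open import Data.Rational.Properties using (_≟_)
open import Data.List using (List; []; _∷_; map; upTo; concatMap; length)
open import Relation.Nullary using (yes; no)
open import Data.Sum using (_⊎_)
open import Data.Product using (_×_)
import Data.Integer.Divisibility as ℤD

data ℚ∞ : Set where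
  fin : ℚ → ℚ∞
  ∞   : ℚ∞

inv∞ : ℚ∞ → ℚ∞
inv∞ ∞ = fin 0ℚ
inv∞ (fin q) with q ≟ 0ℚ
... | yes _ = ∞
... | no q≢0 = fin ((1/ q) {{≢-nonZero q≢0}})

addℤ∞ : ℤ → ℚ∞ → ℚ∞
addℤ∞ c ∞ = ∞
addℤ∞ c (fin q) = fin (ℚ._+_ (ℚ._/_ c 1) q)

cf : List ℤ → ℚ∞
cf [] = ∞
cf (c ∷ cs) = addℤ∞ c (inv∞ (cf cs))

-- division helpers (the zero-divisor fallback is never used in the theorem)

divℕ : ℕ → ℕ → ℕ
divℕ a zero = 0
divℕ a (suc b) = ℕB._/_ a (suc b)

divℤ : ℤ → ℕ → ℤ
divℤ a zero = + 0
divℤ a (suc b) = a /ℕ suc b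

frac : ℤ → ℕ → ℚ
frac p zero = 0ℚ
frac p (suc q) = ℚ._/_ p (suc q)

vSeq : ℕ → ℕ → ℕ
vSeq v zero = v
vSeq v (suc zero) = 1
vSeq v (suc (suc n)) = vSeq v n

aSeq : ℕ → ℕ → ℤ → ℕ → ℤ
aSeq v m ε zero = + 0
aSeq v m ε (suc zero) = + 1
aSeq v m ε (suc (suc n)) =
  ℤ._+_ (ℤ._*_ (+ (ℕ._*_ (vSeq v (suc n)) m)) (aSeq v m ε (suc n)))
        (ℤ._*_ ε (aSeq v m ε n))

-- a_{n-1}; for n = 0 (where the modulus is 1) we put 0
aPrev : ℕ → ℕ → ℤ → ℕ → ℤ
aPrev v m ε zero = + 0
aPrev v m ε (suc n) = aSeq v m ε n

sSeq : ℕ → ℕ → ℕ → ℤ → ℕ → ℕ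
sSeq s v m ε n = gcd ∣ aSeq v m ε n ∣ s

modulus : ℕ → ℕ → ℕ → ℤ → ℕ → ℕ
modulus s v m ε n = divℕ s (sSeq s v m ε n)

IsMSeq : ℕ → ℕ → ℕ → ℤ → (ℕ → ℤ) → Set
IsMSeq s v m ε mseq = ∀ n →
  (+ 0 ℤ.≤ mseq n) ×
  (mseq n ℤ.< + (modulus s v m ε n)) ×
  (ℤD._∣_ (+ (modulus s v m ε n))
    (ℤ._-_ (ℤ._*_ (mseq n) (divℤ (aSeq v m ε n) (sSeq s v m ε n)))
           (ℤ.- aPrev v m ε n)))

xiHat : ℕ → ℕ → ℕ → ℤ → (ℕ → ℤ) → ℕ → ℚ
xiHat s v m ε mseq n =
  frac (ℤ._-_ (+ (ℕ._*_ (ℕ._*_ (sSeq s v m ε n) (vSeq v n)) m)) (ℤ._*_ ε (mseq n)))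
       (modulus s v m ε n)

-- δ_ε = 0 if ε = 1, 1 if ε = -1  (ε ∈ {1,-1} is a hypothesis)
δ : ℤ → ℚ
δ (+ _) = 0ℚ
δ ℤ.-[1+ _ ] = ℚ.1ℚ

oddℕ : ℕ → Set
oddℕ n = ℕB._%_ n 2 ≡′ 1
  where open import Relation.Binary.PropositionalEquality renaming (_≡_ to _≡′_)

evenℕ : ℕ → Set
evenℕ n = ℕB._%_ n 2 ≡′ 0
  where open import Relation.Binary.PropositionalEquality renaming (_≡_ to _≡′_)

RightParity : ℤ → ℕ → Set
RightParity (+ _) len = oddℕ len
RightParity ℤ.-[1+ _ ] len = evenℕ len

IsCFExpansion : ℚ → List ℤ → Set
IsCFExpansion q [] = ⊥′
  where open import Data.Empty renaming (⊥ to ⊥′)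
IsCFExpansion q (c ∷ cs) = All′ (λ x → + 0 ℤ.< x) cs × (cf (c ∷ cs) ≡′ fin q)
  where open import Data.List.Relation.Unary.All renaming (All to All′)
        open import Relation.Binary.PropositionalEquality renaming (_≡_ to _≡′_)

IsBlocks : ℕ → ℕ → ℕ → ℤ → (ℕ → ℤ) → (ℕ → List ℤ) → Set
IsBlocks s v m ε mseq E = ∀ n →
  IsCFExpansion (target n) (E n) × RightParity ε (length (E n))
  where
  target : ℕ → ℚ
  target zero = xiHat s v m ε mseq zero
  target (suc n) = ℚ._-_ (xiHat s v m ε mseq (suc n)) (δ ε)

blocks : (ℕ → List ℤ) → ℕ → List ℤ
blocks E n = concatMap E (upTo n)

nthOr : ℤ → List ℤ → ℕ → ℤ
nthOr d [] _ = d
nthOr d (x ∷ xs) zero = x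
nthOr d (x ∷ xs) (suc j) = nthOr d xs j

-- the j-th term c_j of [C] = E_0, E_1, …  (every E_n is nonempty, so
-- c_j lies in E_0,…,E_j)
cTerm : (ℕ → List ℤ) → ℕ → ℤ
cTerm E j = nthOr (+ 0) (blocks E (suc j)) j

truncation : (ℕ → List ℤ) → ℕ → ℚ∞
truncation E j = cf (map (cTerm E) (upTo (suc j)))

dVal : ℕ → ℕ → ℕ → ℚ
dVal s v m = frac (+ (ℕ._*_ (ℕ._*_ s v) m)) 2

kVal : ℕ → ℕ → ℕ → ℤ → ℚ
kVal s v m ε = frac (ℤ._*_ (+ (ℕ._*_ (ℕ._*_ s s) v))
                           (ℤ._+_ (+ (ℕ._*_ (ℕ._*_ v m) m)) (ℤ._*_ (+ 4) ε))) 4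

-- x < √k  (k > 0)
LtSqrt : ℚ → ℚ → Set
LtSqrt x k = (x ℚ.< 0ℚ) ⊎ (ℚ._*_ x x ℚ.< k)

SqrtLt : ℚ → ℚ → Set
SqrtLt k x = (0ℚ ℚ.≤ x) × (k ℚ.< ℚ._*_ x x)

-- |q - ξ| < r, i.e. q - r < d + √k < q + r
CloseToXi : ℕ → ℕ → ℕ → ℤ → ℚ → ℚ → Set
CloseToXi s v m ε r q =
  LtSqrt (ℚ._-_ (ℚ._-_ q r) (dVal s v m)) (kVal s v m ε) ×
  SqrtLt (kVal s v m ε) (ℚ._-_ (ℚ._+_ q r) (dVal s v m))

TendsToXi : ℕ → ℕ → ℕ → ℤ → (ℕ → ℚ∞) → Set
TendsToXi s v m ε x = ∀ (r : ℚ) → 0ℚ ℚ.< r →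
  Σ′ ℕ λ J → ∀ j → J ℕ.≤ j → Σ′ ℚ λ q → (x j ≡′ fin q) × CloseToXi s v m ε r q
  where open import Data.Product renaming (Σ to Σ′)
        open import Relation.Binary.PropositionalEquality renaming (_≡_ to _≡′_)

-- f_ξ(x) = svm + ε s² v / x on ℚ ∪ {∞}   (ε s² v ≠ 0, so f(0) = ∞)
-- NOTE: the informal statement prints "svm - ε s²v/x"; that is a sign typo.  With "+", ξ is the fixed point of f_ξ.

fXi : ℕ → ℕ → ℕ → ℤ → ℚ∞ → ℚ∞
fXi s v m ε x with inv∞ x
... | ∞ = ∞
... | fin y = fin (ℚ._+_ (frac (+ (ℕ._*_ (ℕ._*_ s v) m)) 1)
                        (ℚ._*_ (frac (ℤ._*_ ε (+ (ℕ._*_ (ℕ._*_ s s) v))) 1) y))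

iter : (ℚ∞ → ℚ∞) → ℕ → ℚ∞ → ℚ∞
iter f zero x = x
iter f (suc n) x = f (iter f n x)

{-# OPTIONS --safe #-}
-- Write D_n for the product of the matrices (c 1 ; 1 0) over the terms c of E_0,…,E_{n-1}.  Its first
-- column represents the value of that continued fraction.  Both rows (T x) of D_n are governed by a solution
-- z of the recurrence z_{n+1} = v_n m z_n + ε z_{n-1}, namely
--   s_n T = z_n   and   (s/s_n) x = ε (m_n T + z_{n-1}) + δ_n (s/s_n) T,
-- with z_n = s v_{n+1} a_{n+1} for the top row and z_n = a_n for the bottom row (δ_0 = 0, δ_n = δ_ε for
-- n ≥ 1).  Hence the value is s v_{n+1} a_{n+1} / a_n, which is f_ξ^n(∞).  The induction rests on the matrix
-- (P p ; Q q) of E_n: ξ̂_n has denominator s/s_n and cancels exactly the factor s_{n+1}, and the parity of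
-- the length of E_n fixes both the determinant −ε and the range of q, so that q is the residue
-- s_n q = ε m_{n+1} + δ_ε s/s_{n+1}.
--
-- For the convergence, v_{n+1} a_{n+1}² − v m a_{n+1} a_n − ε v_n a_n² = (−ε)^n shows that
-- (f_ξ^n(∞) − d)² − k is O(1/a_n²).  A truncation inside E_n has the form D_n (p q) with 1 ≤ q ≤ s.  Its
-- denominator cannot vanish once the (2,1) entry B of D_n exceeds s, because that entry would divide q;
-- being a nonzero integer, it keeps the truncation within s/B of f_ξ^n(∞), whatever the signs of the terms.
module Submission where

open import Defs
open import Data.Nat as ℕ using (ℕ; zero; suc)
import Data.Nat.Properties as ℕ
import Data.Nat.Divisibility as ℕ
import Data.Nat.DivMod as ℕ
open import Data.Nat.Coprimality as Coprimality using (Coprime; coprime-/gcd)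
open import Data.Nat.GCD using (gcd-identityˡ; gcd[m,n]≢0; gcd[m,n]∣m; gcd[m,n]∣n; gcd[m,n]≤n; gcd-greatest)
open import Data.Integer as ℤ using (ℤ; 1ℤ; -1ℤ)
open import Data.Product using (_×_; _,_; proj₁; proj₂; Σ; ∃; ∃₂)
open import Data.Sum using (_⊎_; inj₁; inj₂)
open import Data.Empty using (⊥-elim)
open import Data.List using (List; []; _∷_; _++_; length; take; drop; map; upTo; applyUpTo; concatMap)
open import Function.Base using (_∘_)
open import Relation.Nullary using (¬_; Dec; yes; no)
open import Relation.Binary.PropositionalEquality

-- Order, divisibility and residues in the integers.

module IntegerLemmas where

  open import Data.Integer hiding (suc)
  open import Data.Integer.Properties
  open import Data.Integer.Divisibility.Signed
  open import Data.Integer.Tactic.RingSolver using (solve-∀)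

  -- Inequalities i ≤ j are proved by exhibiting j - i as a sum of products of nonnegative terms.
  infixl 6 _⊕_
  infixl 7 _⊗_

  _⊕_ : ∀ {i j} → 0ℤ ≤ i → 0ℤ ≤ j → 0ℤ ≤ i + j
  _⊕_ = +-mono-≤

  _⊗_ : ∀ {i j} → 0ℤ ≤ i → 0ℤ ≤ j → 0ℤ ≤ i * j
  _⊗_ {+ m} {+ n} _ _ = subst (0ℤ ≤_) (pos-* m n) (+≤+ ℕ.z≤n)

  ≤-from-difference : ∀ {i j d} → j - i ≡ d → 0ℤ ≤ d → i ≤ j
  ≤-from-difference eq 0≤d = 0≤i-j⇒j≤i (subst (0ℤ ≤_) (sym eq) 0≤d)

  0≤1 : 0ℤ ≤ 1ℤ
  0≤1 = +≤+ ℕ.z≤n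

  0≤+ : ∀ n → 0ℤ ≤ + n
  0≤+ n = +≤+ ℕ.z≤n

  ≤-*ˡ : ∀ {x y} → 1ℤ ≤ x → 0ℤ ≤ y → y ≤ x * y
  ≤-*ˡ {x} {y} 1≤x 0≤y = ≤-from-difference (id x y) (i≤j⇒0≤j-i 1≤x ⊗ 0≤y)
    where
    id : ∀ x y → x * y - y ≡ (x - 1ℤ) * y
    id = solve-∀

  1≤⇒≢0 : ∀ {i} → 1ℤ ≤ i → i ≢ 0ℤ
  1≤⇒≢0 1≤0 refl with 1≤0
  ... | +≤+ ()

  ±1⇒≢0 : ∀ {i} → i ≡ 1ℤ ⊎ i ≡ -1ℤ → i ≢ 0ℤ
  ±1⇒≢0 (inj₁ refl) ()
  ±1⇒≢0 (inj₂ refl) ()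

  *-≢0 : ∀ {i j} → i ≢ 0ℤ → j ≢ 0ℤ → i * j ≢ 0ℤ
  *-≢0 {i} i≢0 j≢0 ij≡0 with i*j≡0⇒i≡0∨j≡0 i ij≡0
  ... | inj₁ i≡0 = i≢0 i≡0
  ... | inj₂ j≡0 = j≢0 j≡0

  ±1⇒²≡1 : ∀ {u} → u ≡ 1ℤ ⊎ u ≡ -1ℤ → u * u ≡ 1ℤ
  ±1⇒²≡1 (inj₁ refl) = refl
  ±1⇒²≡1 (inj₂ refl) = refl

  -- A column of a matrix of determinant ±1 is primitive, so a pair (N, M) proportional to (P, Q) is
  -- an integer multiple of it. The factor `G` is the first coordinate of the inverse matrix applied
  -- to (N, M).
  module CommonFactor {P p Q q N M σ : ℤ} (σ²≡1 : σ * σ ≡ 1ℤ)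
    (det : P * q - p * Q ≡ σ) (cross : P * M ≡ N * Q) where

    G : ℤ
    G = σ * (N * q - p * M)

    private
      unit : ∀ {i} → σ * σ * i ≡ i
      unit {i} = trans (cong (_* i) σ²≡1) (*-identityˡ i)

    N≡G*P : N ≡ G * P
    N≡G*P = begin
      N                                 ≡⟨ unit ⟨
      σ * σ * N                         ≡⟨ cong (λ t → σ * t * N) det ⟨
      σ * (P * q - p * Q) * N           ≡⟨ id₁ P p Q q N σ ⟩
      σ * (N * P * q - p * (N * Q))     ≡⟨ cong (λ t → σ * (N * P * q - p * t)) cross ⟨
      σ * (N * P * q - p * (P * M))     ≡⟨ id₂ P p q N M σ ⟩
      σ * (N * q - p * M) * P           ∎
      where
      open ≡-Reasoning
      id₁ : ∀ P p Q q N σ → σ * (P * q - p * Q) * N ≡ σ * (N * P * q - p * (N * Q))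
      id₁ = solve-∀
      id₂ : ∀ P p q N M σ → σ * (N * P * q - p * (P * M)) ≡ σ * (N * q - p * M) * P
      id₂ = solve-∀

    M≡G*Q : M ≡ G * Q
    M≡G*Q = begin
      M                             ≡⟨ unit ⟨
      σ * σ * M                     ≡⟨ cong (λ t → σ * t * M) det ⟨
      σ * (P * q - p * Q) * M       ≡⟨ id₁ P p Q q M σ ⟩
      σ * (P * M * q - p * Q * M)   ≡⟨ cong (λ t → σ * (t * q - p * Q * M)) cross ⟩
      σ * (N * Q * q - p * Q * M)   ≡⟨ id₂ p Q q N M σ ⟩
      σ * (N * q - p * M) * Q       ∎
      where
      open ≡-Reasoning
      id₁ : ∀ P p Q q M σ → σ * (P * q - p * Q) * M ≡ σ * (P * M * q - p * Q * M)
      id₁ = solve-∀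
      id₂ : ∀ p Q q N M σ → σ * (N * Q * q - p * Q * M) ≡ σ * (N * q - p * M) * Q
      id₂ = solve-∀

    -- `G` is an integer combination of `N` and `M`; together with the two factorizations this makes
    -- it their gcd up to sign.
    G-greatest : ∀ {d} → d ∣ N → d ∣ M → d ∣ G
    G-greatest d∣N d∣M = ∣n⇒∣m*n σ (∣m∣n⇒∣m-n (∣m⇒∣m*n q d∣N) (∣n⇒∣m*n p d∣M))

  positive-factor : ∀ {i j} → 0ℤ ≤ j → 0ℤ < i * j → 0ℤ < i
  positive-factor {i} {j} 0≤j 0<ij = *-cancelʳ-<-nonNeg j {{nonNegative 0≤j}} (subst (_< i * j) (sym (*-zeroˡ j)) 0<ij)

  ∣-antisym-pos : ∀ {i j} → 0ℤ ≤ i → 0ℤ ≤ j → i ∣ j → j ∣ i → i ≡ j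
  ∣-antisym-pos {i} {j} 0≤i 0≤j i∣j j∣i =
    trans (sym (0≤i⇒+∣i∣≡i 0≤i)) (trans (cong +_ (ℕ.∣-antisym (∣⇒∣ᵤ i∣j) (∣⇒∣ᵤ j∣i))) (0≤i⇒+∣i∣≡i 0≤j))

  -- The Bézout relation times `t` expresses `u * t` through `x * t` and `y * t`, and the unit `u`
  -- is its own inverse.
  coprime-cancel : ∀ α β x y {d u t} → u ≡ 1ℤ ⊎ u ≡ -1ℤ → x * α + y * β ≡ u → d ∣ x * t → d ∣ y * t → d ∣ t
  coprime-cancel α β x y {d} {u} {t} u≡±1 bezout d∣xt d∣yt = subst (d ∣_) eq
    (∣n⇒∣m*n u (∣m∣n⇒∣m+n (∣n⇒∣m*n α d∣xt) (∣n⇒∣m*n β d∣yt)))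
    where
    id : ∀ u α β x y t → u * (α * (x * t) + β * (y * t)) ≡ u * (x * α + y * β) * t
    id = solve-∀
    eq : u * (α * (x * t) + β * (y * t)) ≡ t
    eq = trans (id u α β x y t) (trans (cong (λ w → u * w * t) bezout)
         (trans (cong (_* t) (±1⇒²≡1 u≡±1)) (*-identityˡ t)))

  private
    ∣∧<⇒≡0 : ∀ {M d} → + M ∣ d → 0ℤ ≤ d → d < + M → d ≡ 0ℤ
    ∣∧<⇒≡0 {M} {+ zero} _ _ _ = refl
    ∣∧<⇒≡0 {M} {+ suc d} M∣d _ (+<+ d<M) = ⊥-elim (ℕ.<⇒≱ d<M (ℕ.∣⇒≤ (∣⇒∣ᵤ M∣d)))

  residue-unique : ∀ {M i j} → 0ℤ ≤ i → i < + M → 0ℤ ≤ j → j < + M → + M ∣ i - j → i ≡ j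
  residue-unique {M} {i} {j} 0≤i i<M 0≤j j<M M∣i-j with ≤-total i j
  ... | inj₁ i≤j = sym (i-j≡0⇒i≡j j i (∣∧<⇒≡0 (subst (+ M ∣_) (id i j) (∣m⇒∣-m M∣i-j)) (i≤j⇒0≤j-i i≤j)
          (≤-<-trans (i≤j⇒i-k≤j i {{nonNegative 0≤i}} ≤-refl) j<M)))
    where
    id : ∀ i j → - (i - j) ≡ j - i
    id = solve-∀
  ... | inj₂ j≤i = i-j≡0⇒i≡j i j (∣∧<⇒≡0 M∣i-j (i≤j⇒0≤j-i j≤i)
          (≤-<-trans (i≤j⇒i-k≤j j {{nonNegative 0≤j}} ≤-refl) i<M))

-- Continuants as matrix entries, with bounds for positive terms.

module Continuants where

  open import Data.Integer hiding (suc)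
  open import Data.Integer.Properties
  open import Data.Integer.Tactic.RingSolver using (solve-∀)
  open import Data.List.Relation.Unary.All using (All; []; _∷_)
  open import Data.List.Relation.Unary.All.Properties using (++⁻ˡ; ++⁻ʳ)
  open import Data.List.Properties using (take++drop≡id)
  open IntegerLemmas

  -- The product of the matrices (c 1 ; 1 0) over the list is (num num′ ; den den′), with determinant sgn.
  num den num′ den′ sgn : List ℤ → ℤ
  num [] = 1ℤ
  num (c ∷ cs) = c * num cs + den cs
  den [] = 0ℤ
  den (c ∷ cs) = num cs
  num′ [] = 0ℤ
  num′ (c ∷ cs) = c * num′ cs + den′ cs
  den′ [] = 1ℤ
  den′ (c ∷ cs) = num′ cs
  sgn [] = 1ℤ
  sgn (c ∷ cs) = - sgn cs

  mutual
    num-++ : ∀ xs ys → num (xs ++ ys) ≡ num xs * num ys + num′ xs * den ys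
    num-++ [] ys = id (num ys) (den ys)
      where id : ∀ a b → a ≡ 1ℤ * a + 0ℤ * b
            id = solve-∀
    num-++ (c ∷ xs) ys = trans (cong₂ (λ a b → c * a + b) (num-++ xs ys) (den-++ xs ys))
      (id c (num xs) (num ys) (num′ xs) (den ys) (den xs) (den′ xs))
      where id : ∀ c a b d e f g → c * (a * b + d * e) + (f * b + g * e) ≡ (c * a + f) * b + (c * d + g) * e
            id = solve-∀
    den-++ : ∀ xs ys → den (xs ++ ys) ≡ den xs * num ys + den′ xs * den ys
    den-++ [] ys = id (num ys) (den ys)
      where id : ∀ a b → b ≡ 0ℤ * a + 1ℤ * b
            id = solve-∀
    den-++ (c ∷ xs) ys = num-++ xs ys

  det : ∀ xs → num xs * den′ xs - num′ xs * den xs ≡ sgn xs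
  det [] = refl
  det (c ∷ xs) = trans (id c (num xs) (den xs) (num′ xs) (den′ xs)) (cong -_ (det xs))
    where id : ∀ c a b d e → (c * a + b) * d - (c * d + e) * a ≡ - (a * e - d * b)
          id = solve-∀

  mutual
    num′-++ : ∀ xs ys → num′ (xs ++ ys) ≡ num xs * num′ ys + num′ xs * den′ ys
    num′-++ [] ys = id (num′ ys) (den′ ys)
      where id : ∀ a b → a ≡ 1ℤ * a + 0ℤ * b
            id = solve-∀
    num′-++ (c ∷ xs) ys = trans (cong₂ (λ a b → c * a + b) (num′-++ xs ys) (den′-++ xs ys))
      (id c (num xs) (num′ ys) (num′ xs) (den′ ys) (den xs) (den′ xs))
      where id : ∀ c a b d e f g → c * (a * b + d * e) + (f * b + g * e) ≡ (c * a + f) * b + (c * d + g) * e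
            id = solve-∀
    den′-++ : ∀ xs ys → den′ (xs ++ ys) ≡ den xs * num′ ys + den′ xs * den′ ys
    den′-++ [] ys = id (num′ ys) (den′ ys)
      where id : ∀ a b → b ≡ 0ℤ * a + 1ℤ * b
            id = solve-∀
    den′-++ (c ∷ xs) ys = num′-++ xs ys

  -- For positive terms.  The slack in den′≤1+den is needed for the empty list, where den′ = 1 and den = 0.
  record EvenBounds (xs : List ℤ) : Set where
    field
      num′-nonneg : 0ℤ ≤ num′ xs
      num′<num    : num′ xs + 1ℤ ≤ num xs
      den′-pos    : 1ℤ ≤ den′ xs
      den-nonneg  : 0ℤ ≤ den xs
      den′≤1+den  : den′ xs ≤ den xs + 1ℤ

  record OddBounds (xs : List ℤ) : Set where
    field
      num′-pos    : 1ℤ ≤ num′ xs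
      num′≤num    : num′ xs ≤ num xs
      den′-nonneg : 0ℤ ≤ den′ xs
      den′<den    : den′ xs + 1ℤ ≤ den xs

  oddBounds-∷ : ∀ {c xs} → 1ℤ ≤ c → EvenBounds xs → OddBounds (c ∷ xs)
  oddBounds-∷ {c} {xs} 1≤c b = record
    { num′-pos    = ≤-from-difference (id₁ c (num′ xs) (den′ xs)) (0≤c ⊗ num′-nonneg ⊕ i≤j⇒0≤j-i den′-pos)
    ; num′≤num    = ≤-from-difference (id₂ c (num xs) (num′ xs) (den xs) (den′ xs))
                      (0≤c ⊗ i≤j⇒0≤j-i num′<num ⊕ i≤j⇒0≤j-i 1≤c ⊕ i≤j⇒0≤j-i den′≤1+den)
    ; den′-nonneg = num′-nonneg
    ; den′<den    = num′<num
    }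
    where
    open EvenBounds b
    0≤c = ≤-trans 0≤1 1≤c
    id₁ : ∀ c p q → c * p + q - 1ℤ ≡ c * p + (q - 1ℤ)
    id₁ = solve-∀
    id₂ : ∀ c P p Q q → c * P + Q - (c * p + q) ≡ c * (P - (p + 1ℤ)) + (c - 1ℤ) + (Q + 1ℤ - q)
    id₂ = solve-∀

  evenBounds-∷ : ∀ {c xs} → 1ℤ ≤ c → OddBounds xs → EvenBounds (c ∷ xs)
  evenBounds-∷ {c} {xs} 1≤c b = record
    { num′-nonneg = 0≤c ⊗ 0≤num′ ⊕ den′-nonneg
    ; num′<num    = ≤-from-difference (id₁ c (num xs) (num′ xs) (den xs) (den′ xs))
                      (0≤c ⊗ i≤j⇒0≤j-i num′≤num ⊕ i≤j⇒0≤j-i den′<den)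
    ; den′-pos    = num′-pos
    ; den-nonneg  = ≤-trans 0≤num′ num′≤num
    ; den′≤1+den  = ≤-trans num′≤num (≤-from-difference (id₂ (num xs)) 0≤1)
    }
    where
    open OddBounds b
    0≤c = ≤-trans 0≤1 1≤c
    0≤num′ = ≤-trans 0≤1 num′-pos
    id₁ : ∀ c P p Q q → c * P + Q - (c * p + q + 1ℤ) ≡ c * (P - p) + (Q - (q + 1ℤ))
    id₁ = solve-∀
    id₂ : ∀ P → P + 1ℤ - P ≡ 1ℤ
    id₂ = solve-∀

  Pos : List ℤ → Set
  Pos = All (0ℤ <_)

  -- Prepending a positive term turns one kind of bounds into the other and flips the determinant,
  -- so the sign alone tells which bounds hold.
  bounds : ∀ {xs} → Pos xs → (sgn xs ≡ 1ℤ × EvenBounds xs) ⊎ (sgn xs ≡ -1ℤ × OddBounds xs)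
  bounds [] = inj₁ (refl , record
    { num′-nonneg = ≤-refl ; num′<num = ≤-refl ; den′-pos = ≤-refl ; den-nonneg = ≤-refl ; den′≤1+den = ≤-refl })
  bounds (0<c ∷ 0<cs) with bounds 0<cs
  ... | inj₁ (sgn≡ , b) = inj₂ (cong -_ sgn≡ , oddBounds-∷ (i<j⇒suc[i]≤j 0<c) b)
  ... | inj₂ (sgn≡ , b) = inj₁ (cong -_ sgn≡ , evenBounds-∷ (i<j⇒suc[i]≤j 0<c) b)

  num-pos : ∀ {xs} → Pos xs → 1ℤ ≤ num xs
  num-pos 0<xs with bounds 0<xs
  ... | inj₁ (_ , b) = ≤-trans (+-monoˡ-≤ 1ℤ num′-nonneg) num′<num where open EvenBounds b
  ... | inj₂ (_ , b) = ≤-trans num′-pos num′≤num where open OddBounds b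

  num′-nonneg : ∀ {xs} → Pos xs → 0ℤ ≤ num′ xs
  num′-nonneg 0<xs with bounds 0<xs
  ... | inj₁ (_ , b) = EvenBounds.num′-nonneg b
  ... | inj₂ (_ , b) = ≤-trans 0≤1 (OddBounds.num′-pos b)

  den-nonneg : ∀ {xs} → Pos xs → 0ℤ ≤ den xs
  den-nonneg [] = ≤-refl
  den-nonneg (_ ∷ 0<xs) = ≤-trans 0≤1 (num-pos 0<xs)

  num-prefix-≤ : ∀ xs ys → Pos (xs ++ ys) → num xs ≤ num (xs ++ ys)
  num-prefix-≤ xs ys 0<xsys = ≤-from-difference
    (trans (cong (_- num xs) (num-++ xs ys)) (id (num xs) (num ys) (num′ xs) (den ys)))
    (≤-trans 0≤1 (num-pos 0<xs) ⊗ i≤j⇒0≤j-i (num-pos 0<ys) ⊕ num′-nonneg 0<xs ⊗ den-nonneg 0<ys)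
    where
    0<xs = ++⁻ˡ xs 0<xsys
    0<ys = ++⁻ʳ xs 0<xsys
    id : ∀ a b c d → a * b + c * d - a ≡ a * (b - 1ℤ) + c * d
    id = solve-∀

  -- Removing two terms at a time preserves both the sign and the length modulo 2.
  RightParity⇒sgn : ∀ {ε} → ε ≡ 1ℤ ⊎ ε ≡ -1ℤ → ∀ xs → RightParity ε (length xs) → sgn xs ≡ - ε
  RightParity⇒sgn (inj₁ refl) (x ∷ []) _ = refl
  RightParity⇒sgn (inj₁ refl) (x ∷ y ∷ xs) par =
    trans (neg-involutive (sgn xs)) (RightParity⇒sgn (inj₁ refl) xs par)
  RightParity⇒sgn (inj₂ refl) [] _ = refl
  RightParity⇒sgn (inj₂ refl) (x ∷ y ∷ xs) par =
    trans (neg-involutive (sgn xs)) (RightParity⇒sgn (inj₂ refl) xs par)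

  sgn-±1 : ∀ xs → sgn xs ≡ 1ℤ ⊎ sgn xs ≡ -1ℤ
  sgn-±1 [] = inj₁ refl
  sgn-±1 (x ∷ xs) with sgn-±1 xs
  ... | inj₁ eq = inj₂ (cong -_ eq)
  ... | inj₂ eq = inj₁ (cong -_ eq)

  ∣sgn∣≡1 : ∀ xs → ∣ sgn xs ∣ ≡ 1
  ∣sgn∣≡1 xs with sgn-±1 xs
  ... | inj₁ eq = cong ∣_∣ eq
  ... | inj₂ eq = cong ∣_∣ eq

  IsCFExpansion⇒nonempty : ∀ {q} xs → IsCFExpansion q xs → 1 ℕ.≤ length xs
  IsCFExpansion⇒nonempty (_ ∷ _) _ = ℕ.s≤s ℕ.z≤n

  -- The first term may be zero or negative, but it does not enter the denominator: `den (c ∷ cs)`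
  -- is `num cs`, a continuant of positive terms, and such continuants do not decrease when the list
  -- is extended.
  den-prefix : ∀ {q} xs → IsCFExpansion q xs → ∀ k →
    1ℤ ≤ den (take (suc k) xs) × den (take (suc k) xs) ≤ den xs
  den-prefix (c ∷ cs) (0<cs , _) k =
    num-pos (++⁻ˡ (take k cs) 0<cs′) ,
    subst (λ ys → num (take k cs) ≤ num ys) (take++drop≡id k cs) (num-prefix-≤ (take k cs) (drop k cs) 0<cs′)
    where
    0<cs′ : Pos (take k cs ++ drop k cs)
    0<cs′ = subst Pos (sym (take++drop≡id k cs)) 0<cs

-- The embedding of the integers in the rationals.

module Embedding where

  open import Data.Integer as ℤ using (+_; -[1+_]; 0ℤ; +≤+)
  import Data.Integer.Properties as ℤ
  import Data.Integer.Tactic.RingSolver as ℤ-Solver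
  open import Data.Rational
  open import Data.Rational.Properties
  import Data.Rational.Unnormalised as ℚᵘ
  import Data.Rational.Unnormalised.Properties as ℚᵘ
  open import Level using (0ℓ)
  open import Relation.Nullary.Decidable using (dec⇒maybe)
  open import Tactic.RingSolver using (solve-∀)
  open import Tactic.RingSolver.Core.AlmostCommutativeRing using (AlmostCommutativeRing; fromCommutativeRing)

  ℚ-ring : AlmostCommutativeRing 0ℓ 0ℓ
  ℚ-ring = fromCommutativeRing +-*-commutativeRing λ x → dec⇒maybe (0ℚ ≟ x)

  ι : ℤ → ℚ
  ι i = i / 1

  toℚᵘ-ι : ∀ i → toℚᵘ (ι i) ℚᵘ.≃ ℚᵘ.mkℚᵘ i 0
  toℚᵘ-ι i = toℚᵘ-fromℚᵘ (ℚᵘ.mkℚᵘ i 0)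

  ι-+ : ∀ i j → ι (i ℤ.+ j) ≡ ι i + ι j
  ι-+ i j = toℚᵘ-injective (begin
    toℚᵘ (ι (i ℤ.+ j)) ≈⟨ toℚᵘ-ι (i ℤ.+ j) ⟩
    ℚᵘ.mkℚᵘ (i ℤ.+ j) 0 ≈⟨ ℚᵘ.*≡* (cong (ℤ._* + 1) (sym (cong₂ ℤ._+_ (ℤ.*-identityʳ i) (ℤ.*-identityʳ j)))) ⟩
    ℚᵘ.mkℚᵘ i 0 ℚᵘ.+ ℚᵘ.mkℚᵘ j 0 ≈⟨ ℚᵘ.+-cong (toℚᵘ-ι i) (toℚᵘ-ι j) ⟨
    toℚᵘ (ι i) ℚᵘ.+ toℚᵘ (ι j) ≈⟨ toℚᵘ-homo-+ (ι i) (ι j) ⟨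
    toℚᵘ (ι i + ι j) ∎)
    where open ℚᵘ.≃-Reasoning

  ι-* : ∀ i j → ι (i ℤ.* j) ≡ ι i * ι j
  ι-* i j = toℚᵘ-injective (begin
    toℚᵘ (ι (i ℤ.* j)) ≈⟨ toℚᵘ-ι (i ℤ.* j) ⟩
    ℚᵘ.mkℚᵘ i 0 ℚᵘ.* ℚᵘ.mkℚᵘ j 0 ≈⟨ ℚᵘ.*-cong (toℚᵘ-ι i) (toℚᵘ-ι j) ⟨
    toℚᵘ (ι i) ℚᵘ.* toℚᵘ (ι j) ≈⟨ toℚᵘ-homo-* (ι i) (ι j) ⟨
    toℚᵘ (ι i * ι j) ∎)
    where open ℚᵘ.≃-Reasoning

  ι-injective : ∀ {i j} → ι i ≡ ι j → i ≡ j
  ι-injective {i} {j} eq with /-injective-≃ (ℚᵘ.mkℚᵘ i 0) (ℚᵘ.mkℚᵘ j 0) eq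
  ... | ℚᵘ.*≡* e = ℤ.*-cancelʳ-≡ i j (+ 1) e

  ι-mono-≤ : ∀ {i j} → i ℤ.≤ j → ι i ≤ ι j
  ι-mono-≤ {i} {j} i≤j = toℚᵘ-cancel-≤ (ℚᵘ.≤-respʳ-≃ (ℚᵘ.≃-sym (toℚᵘ-ι j)) (ℚᵘ.≤-respˡ-≃ (ℚᵘ.≃-sym (toℚᵘ-ι i))
    (ℚᵘ.*≤* (ℤ.*-monoʳ-≤-nonNeg (+ 1) i≤j))))

  /-*-cancel : ∀ i n .{{_ : ℕ.NonZero n}} → i / n * ι (+ n) ≡ ι i
  /-*-cancel i n@(suc n-1) = toℚᵘ-injective (begin
    toℚᵘ (i / n * ι (+ n)) ≈⟨ toℚᵘ-homo-* (i / n) (ι (+ n)) ⟩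
    toℚᵘ (i / n) ℚᵘ.* toℚᵘ (ι (+ n)) ≈⟨ ℚᵘ.*-cong (toℚᵘ-fromℚᵘ (ℚᵘ.mkℚᵘ i n-1)) (toℚᵘ-ι (+ n)) ⟩
    ℚᵘ.mkℚᵘ i n-1 ℚᵘ.* ℚᵘ.mkℚᵘ (+ n) 0 ≈⟨ ℚᵘ.*≡* (trans (ℤ.*-identityʳ _) (cong (i ℤ.*_) (sym (ℤ.*-identityʳ (+ n))))) ⟩
    ℚᵘ.mkℚᵘ i 0 ≈⟨ toℚᵘ-ι i ⟨
    toℚᵘ (ι i) ∎)
    where open ℚᵘ.≃-Reasoning

  *-cancelʳ-≢0 : ∀ r {p q} → r ≢ 0ℚ → p * r ≡ q * r → p ≡ q
  *-cancelʳ-≢0 r {p} {q} r≢0 eq = begin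
    p ≡⟨ strip p ⟩
    p * r * (1/ r) ≡⟨ cong (_* (1/ r)) eq ⟩
    q * r * (1/ r) ≡⟨ strip q ⟨
    q ∎
    where
    open ≡-Reasoning
    instance _ = ≢-nonZero r≢0
    strip : ∀ x → x ≡ x * r * (1/ r)
    strip x = sym (trans (*-assoc x r (1/ r)) (trans (cong (x *_) (*-inverseʳ r)) (*-identityʳ x)))

  ι-mono-< : ∀ {i j} → i ℤ.< j → ι i < ι j
  ι-mono-< {i} {j} i<j = toℚᵘ-cancel-< (ℚᵘ.<-respʳ-≃ (ℚᵘ.≃-sym (toℚᵘ-ι j)) (ℚᵘ.<-respˡ-≃ (ℚᵘ.≃-sym (toℚᵘ-ι i))
    (ℚᵘ.*<* (ℤ.*-monoʳ-<-pos (+ 1) i<j))))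

  ι-- : ∀ i j → ι (i ℤ.- j) ≡ ι i - ι j
  ι-- i j = trans (cancel (ι (i ℤ.- j)) (ι j)) (cong (_- ι j) (trans (sym (ι-+ (i ℤ.- j) j)) (cong ι (id i j))))
    where
    cancel : ∀ x y → x ≡ x + y - y
    cancel = solve-∀ ℚ-ring
    id : ∀ i j → i ℤ.- j ℤ.+ j ≡ i
    id = ℤ-Solver.solve-∀

  ∣ι∣ : ∀ i → ∣ ι i ∣ ≡ ι (+ ℤ.∣ i ∣)
  ∣ι∣ (+ n) = 0≤p⇒∣p∣≡p (ι-mono-≤ {0ℤ} {+ n} (+≤+ ℕ.z≤n))
  ∣ι∣ -[1+ n ] = trans (∣-p∣≡∣p∣ (ι (+ suc n))) (∣ι∣ (+ suc n))

  frac-* : ∀ p n .{{_ : ℕ.NonZero n}} → frac p n * ι (+ n) ≡ ι p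
  frac-* p (suc n) = /-*-cancel p (suc n)

-- Rational inequalities, square root estimates and the Archimedean property.

module RationalOrder where

  open import Data.Integer as ℤ using (+_; +[1+_]; 0ℤ; +≤+)
  open import Data.Rational
  open import Data.Rational.Properties
  open import Tactic.RingSolver using (solve-∀)
  open Embedding

  infixl 6 _⊕_ _⊞_
  infixl 7 _⊗_

  _⊕_ : ∀ {p q} → 0ℚ ≤ p → 0ℚ ≤ q → 0ℚ ≤ p + q
  _⊕_ = +-mono-≤

  _⊗_ : ∀ {p q} → 0ℚ ≤ p → 0ℚ ≤ q → 0ℚ ≤ p * q
  _⊗_ {p} {q} 0≤p 0≤q = subst (_≤ p * q) (*-zeroˡ q) (*-monoʳ-≤-nonNeg q {{nonNegative 0≤q}} 0≤p)

  _⊞_ : ∀ {p q} → 0ℚ < p → 0ℚ ≤ q → 0ℚ < p + q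
  _⊞_ = +-mono-<-≤

  p-q+q≡p : ∀ p q → p - q + q ≡ p
  p-q+q≡p = solve-∀ ℚ-ring

  p≤q⇒0≤q-p : ∀ {p q} → p ≤ q → 0ℚ ≤ q - p
  p≤q⇒0≤q-p {p} {q} p≤q = subst (_≤ q - p) (+-inverseʳ p) (+-monoˡ-≤ (- p) p≤q)

  p<q⇒0<q-p : ∀ {p q} → p < q → 0ℚ < q - p
  p<q⇒0<q-p {p} {q} p<q = subst (_< q - p) (+-inverseʳ p) (+-monoˡ-< (- p) p<q)

  0≤q-p⇒p≤q : ∀ {p q} → 0ℚ ≤ q - p → p ≤ q
  0≤q-p⇒p≤q {p} {q} 0≤ = subst₂ _≤_ (+-identityˡ p) (p-q+q≡p q p) (+-monoˡ-≤ p 0≤)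

  0<q-p⇒p<q : ∀ {p q} → 0ℚ < q - p → p < q
  0<q-p⇒p<q {p} {q} 0< = subst₂ _<_ (+-identityˡ p) (p-q+q≡p q p) (+-monoˡ-< p 0<)

  ∣p∣≤q⇒bounds : ∀ {p q} → ∣ p ∣ ≤ q → 0ℚ ≤ q - p × 0ℚ ≤ q + p
  ∣p∣≤q⇒bounds {p} {q} ∣p∣≤q =
    p≤q⇒0≤q-p (≤-trans (p≤∣p∣ p) ∣p∣≤q) ,
    subst (λ x → 0ℚ ≤ q + x) (neg-neg p)
      (p≤q⇒0≤q-p (≤-trans (subst (- p ≤_) (∣-p∣≡∣p∣ p) (p≤∣p∣ (- p))) ∣p∣≤q))
    where
    p≤∣p∣ : ∀ p → p ≤ ∣ p ∣
    p≤∣p∣ p with ∣p∣≡p∨∣p∣≡-p p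
    ... | inj₁ eq = ≤-reflexive (sym eq)
    ... | inj₂ eq = 0≤q-p⇒p≤q (subst (λ x → 0ℚ ≤ ∣ p ∣ + x) eq (0≤∣p∣ p ⊕ 0≤∣p∣ p))
    neg-neg : ∀ p → - - p ≡ p
    neg-neg = solve-∀ ℚ-ring

  -- Put w = Y - d. When √k is real, (w - √k)² ≤ |w² - k| < ρ² because w ≥ 0, so w is within ρ of
  -- √k, and passing from `Y` to `X` costs another ρ. The argument compares squares only, so no root
  -- has to be constructed.
  sqrt-window : ∀ {X Y d k ρ} → 0ℚ ≤ ρ → 0ℚ ≤ Y - d → ∣ X - Y ∣ ≤ ρ →
    (Y - d) * (Y - d) - k < ρ * ρ → k - (Y - d) * (Y - d) < ρ * ρ →
    LtSqrt (X - (ρ + ρ) - d) k × SqrtLt k (X + (ρ + ρ) - d)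
  sqrt-window {X} {Y} {d} {k} {ρ} 0≤ρ 0≤w close upper lower =
    left (u <? 0ℚ) , (subst (0ℚ ≤_) (sym (id₂ X Y d ρ)) (0≤w ⊕ 0≤ρ ⊕ 0≤e′) , right)
    where
    u : ℚ
    u = X - (ρ + ρ) - d
    0≤e : 0ℚ ≤ ρ - (X - Y)
    0≤e = proj₁ (∣p∣≤q⇒bounds close)
    0≤e′ : 0ℚ ≤ ρ + (X - Y)
    0≤e′ = proj₂ (∣p∣≤q⇒bounds close)
    left : Dec (u < 0ℚ) → LtSqrt u k
    left (yes u<0) = inj₁ u<0
    -- With w = Y - d, `0 ≤ u` forces w ≥ ρ, and u ≤ w - ρ gives u² ≤ (w - ρ)² ≤ w² - ρ² < k.
    left (no u≮0) = inj₂ (0<q-p⇒p<q (subst (0ℚ <_) (sym (id₁ X Y d k ρ))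
      (p<q⇒0<q-p upper ⊞ (0≤e ⊗ (0≤w-ρ ⊕ 0≤u) ⊕ (0≤ρ ⊕ 0≤ρ) ⊗ 0≤w-ρ))))
      where
      0≤u : 0ℚ ≤ u
      0≤u = ≮⇒≥ u≮0
      id : ∀ X Y d ρ → Y - d - ρ ≡ X - (ρ + ρ) - d + (ρ - (X - Y))
      id = solve-∀ ℚ-ring
      0≤w-ρ : 0ℚ ≤ Y - d - ρ
      0≤w-ρ = subst (0ℚ ≤_) (sym (id X Y d ρ)) (0≤u ⊕ 0≤e)
      id₁ : ∀ X Y d k ρ → k - (X - (ρ + ρ) - d) * (X - (ρ + ρ) - d) ≡
        (ρ * ρ - ((Y - d) * (Y - d) - k)) +
        ((ρ - (X - Y)) * ((Y - d - ρ) + (X - (ρ + ρ) - d)) + (ρ + ρ) * (Y - d - ρ))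
      id₁ = solve-∀ ℚ-ring
    id₂ : ∀ X Y d ρ → X + (ρ + ρ) - d ≡ Y - d + ρ + (ρ + (X - Y))
    id₂ = solve-∀ ℚ-ring
    right : k < (X + (ρ + ρ) - d) * (X + (ρ + ρ) - d)
    -- With w = Y - d, the quantity squared is at least w + ρ, and (w + ρ)² ≥ w² + ρ² > k.
    right = 0<q-p⇒p<q (subst (0ℚ <_) (sym (id₃ X Y d k ρ))
      (p<q⇒0<q-p lower ⊞ ((0≤w ⊕ 0≤w) ⊗ 0≤ρ ⊕ ((0≤w ⊕ 0≤ρ) ⊕ (0≤w ⊕ 0≤ρ)) ⊗ 0≤e′ ⊕ 0≤e′ ⊗ 0≤e′)))
      where
      id₃ : ∀ X Y d k ρ → (X + (ρ + ρ) - d) * (X + (ρ + ρ) - d) - k ≡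
        (ρ * ρ - (k - (Y - d) * (Y - d))) +
        ((Y - d + (Y - d)) * ρ + ((Y - d + ρ) + (Y - d + ρ)) * (ρ + (X - Y)) + (ρ + (X - Y)) * (ρ + (X - Y)))
      id₃ = solve-∀ ℚ-ring

  archimedean : ∀ {ρ} → 0ℚ < ρ → ∀ (K : ℕ) → ∃ λ (N : ℕ) → ∀ {i} → + N ℤ.≤ i → ι (+ K) < ι i * ρ
  -- Here ρ = (p + 1)/d, so i ≥ (K + 1)d gives iρ ≥ (K + 1)(p + 1) > K.
  archimedean {mkℚ +[1+ p ] d-1 c} _ K = suc K ℕ.* d , λ {i} N≤i → begin-strict
    ι (+ K)                      <⟨ ι-mono-< {+ K} {+ suc K} (ℤ.+<+ (ℕ.n<1+n K)) ⟩
    ι (+ suc K)                  ≡⟨ *-identityʳ (ι (+ suc K)) ⟨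
    ι (+ suc K) * 1ℚ             ≤⟨ *-monoˡ-≤-nonNeg (ι (+ suc K)) {{nonNegative (ι-mono-≤ {0ℤ} {+ suc K} (+≤+ ℕ.z≤n))}}
                                     (ι-mono-≤ {1ℤ} {+[1+ p ]} (+≤+ (ℕ.s≤s ℕ.z≤n))) ⟩
    ι (+ suc K) * ι +[1+ p ]     ≡⟨ cong (ι (+ suc K) *_) ρ*d≡p ⟨
    ι (+ suc K) * (ρ * ι (+ d))  ≡⟨ id (ι (+ suc K)) ρ (ι (+ d)) ⟩
    ι (+ suc K) * ι (+ d) * ρ    ≡⟨ cong (_* ρ) (ι-* (+ suc K) (+ d)) ⟨
    ι (+ suc K ℤ.* + d) * ρ      ≤⟨ *-monoʳ-≤-nonNeg ρ (ι-mono-≤ {+ suc K ℤ.* + d} {i} N≤i) ⟩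
    ι i * ρ                      ∎
    where
    open ≤-Reasoning
    ρ = mkℚ +[1+ p ] d-1 c
    d = suc d-1
    ρ*d≡p : ρ * ι (+ d) ≡ ι +[1+ p ]
    ρ*d≡p = trans (cong (_* ι (+ d)) (sym (↥p/↧p≡p ρ))) (/-*-cancel +[1+ p ] d)
    id : ∀ x y z → x * (y * z) ≡ x * z * y
    id = solve-∀ ℚ-ring
  archimedean {mkℚ (+ zero) _ _} (*<* (ℤ.+<+ ())) K
  archimedean {mkℚ (ℤ.-[1+ _ ]) _ _} (*<* ()) K

-- Homogeneous coordinates on the projective line over the rationals.

module ProjectiveLine where

  open import Data.Integer as ℤ using (+_; 0ℤ)
  import Data.Integer.Properties as ℤ
  open import Data.Rational using (_+_; _*_; 0ℚ; 1ℚ; 1/_; ≢-nonZero)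
  open import Data.Rational.Properties
  open import Tactic.RingSolver using (solve-∀)
  open Continuants
  open Embedding

  -- x = (a : b) in the projective line over ℚ.
  data Rep : ℚ∞ → ℤ → ℤ → Set where
    finite   : ∀ {q a b} → b ≢ 0ℤ → q * ι b ≡ ι a → Rep (fin q) a b
    infinite : ∀ {a b} → a ≢ 0ℤ → b ≡ 0ℤ → Rep ∞ a b

  Rep-fin : ∀ {q a b} → Rep (fin q) a b → q * ι b ≡ ι a
  Rep-fin (finite _ eq) = eq

  ι≢0 : ∀ {i} → i ≢ 0ℤ → ι i ≢ 0ℚ
  ι≢0 i≢0 eq = i≢0 (ι-injective eq)

  Rep-inv : ∀ {x a b} → Rep x a b → Rep (inv∞ x) b a
  Rep-inv {a = a} (infinite a≢0 refl) = finite a≢0 (*-zeroˡ (ι a))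
  Rep-inv {fin q} {a} {b} (finite b≢0 eq) with q ≟ 0ℚ
  ... | yes refl = infinite b≢0 (ι-injective (trans (sym eq) (*-zeroˡ (ι b))))
  ... | no q≢0 = finite a≢0 (begin
    1/ q * ι a       ≡⟨ cong (1/ q *_) eq ⟨
    1/ q * (q * ι b) ≡⟨ *-assoc (1/ q) q (ι b) ⟨
    1/ q * q * ι b   ≡⟨ cong (_* ι b) (*-inverseˡ q) ⟩
    1ℚ * ι b         ≡⟨ *-identityˡ (ι b) ⟩
    ι b              ∎)
    where
    open ≡-Reasoning
    instance _ = ≢-nonZero q≢0
    a≢0 : a ≢ 0ℤ
    a≢0 refl = q≢0 (*-cancelʳ-≢0 (ι b) (ι≢0 b≢0) (trans eq (sym (*-zeroˡ (ι b)))))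

  Rep-add : ∀ c {x a b} → Rep x a b → Rep (addℤ∞ c x) (c ℤ.* b ℤ.+ a) b
  Rep-add c {a = a} (infinite a≢0 refl) =
    infinite (subst (_≢ 0ℤ) (sym (trans (cong (ℤ._+ a) (ℤ.*-zeroʳ c)) (ℤ.+-identityˡ a))) a≢0) refl
  Rep-add c {fin q} {a} {b} (finite b≢0 eq) = finite b≢0 (begin
    (ι c + q) * ι b     ≡⟨ *-distribʳ-+ (ι b) (ι c) q ⟩
    ι c * ι b + q * ι b ≡⟨ cong₂ _+_ (sym (ι-* c b)) eq ⟩
    ι (c ℤ.* b) + ι a   ≡⟨ ι-+ (c ℤ.* b) a ⟨
    ι (c ℤ.* b ℤ.+ a)   ∎)
    where open ≡-Reasoning

  Rep-cf : ∀ xs → Rep (cf xs) (num xs) (den xs)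
  Rep-cf [] = infinite (λ ()) refl
  Rep-cf (c ∷ cs) = Rep-add c (Rep-inv (Rep-cf cs))

  Rep-unique : ∀ {x y a b} → Rep x a b → Rep y a b → x ≡ y
  Rep-unique (finite b≢0 eq) (finite _ eq′) = cong fin (*-cancelʳ-≢0 _ (ι≢0 b≢0) (trans eq (sym eq′)))
  Rep-unique (finite b≢0 _) (infinite _ b≡0) = ⊥-elim (b≢0 b≡0)
  Rep-unique (infinite _ b≡0) (finite b≢0 _) = ⊥-elim (b≢0 b≡0)
  Rep-unique (infinite _ _) (infinite _ _) = refl

  Rep-unscale : ∀ k {x a b} → k ≢ 0ℤ → Rep x (k ℤ.* a) (k ℤ.* b) → Rep x a b
  Rep-unscale k {fin q} {a} {b} k≢0 (finite kb≢0 eq) =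
    finite (λ { refl → kb≢0 (ℤ.*-zeroʳ k) })
           (*-cancelʳ-≢0 (ι k) (ι≢0 k≢0) (begin
             q * ι b * ι k   ≡⟨ rearrange q (ι b) (ι k) ⟩
             q * (ι k * ι b) ≡⟨ cong (q *_) (ι-* k b) ⟨
             q * ι (k ℤ.* b) ≡⟨ eq ⟩
             ι (k ℤ.* a)     ≡⟨ ι-* k a ⟩
             ι k * ι a       ≡⟨ *-comm (ι k) (ι a) ⟩
             ι a * ι k       ∎))
    where
    open ≡-Reasoning
    rearrange : ∀ x y z → x * y * z ≡ x * (z * y)
    rearrange = solve-∀ ℚ-ring
  Rep-unscale k {a = a} {b} k≢0 (infinite ka≢0 kb≡0) with ℤ.i*j≡0⇒i≡0∨j≡0 k kb≡0
  ... | inj₁ k≡0 = ⊥-elim (k≢0 k≡0)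
  ... | inj₂ b≡0 = infinite (λ { refl → ka≢0 (ℤ.*-zeroʳ k) }) b≡0

  -- `fXi` is the Möbius map of the matrix (svm εs²v ; 1 0). That εs²v is nonzero enters at x = 0,
  -- whose image must be the point ∞ and not the invalid pair (0 : 0).
  Rep-fXi : ∀ s v m ε → ε ℤ.* + (s ℕ.* s ℕ.* v) ≢ 0ℤ → ∀ {x a b} → Rep x a b →
    Rep (fXi s v m ε x) (+ (s ℕ.* v ℕ.* m) ℤ.* a ℤ.+ ε ℤ.* + (s ℕ.* s ℕ.* v) ℤ.* b) a
  Rep-fXi s v m ε e≢0 {x} {a} {b} r with inv∞ x | Rep-inv r
  ... | ∞ | infinite b≢0 refl = infinite sum≢0 refl
    where
    t = + (s ℕ.* v ℕ.* m)
    e = ε ℤ.* + (s ℕ.* s ℕ.* v)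
    sum≢0 : t ℤ.* 0ℤ ℤ.+ e ℤ.* b ≢ 0ℤ
    sum≢0 eq with ℤ.i*j≡0⇒i≡0∨j≡0 e
      (trans (sym (ℤ.+-identityˡ (e ℤ.* b))) (trans (cong (ℤ._+ e ℤ.* b) (sym (ℤ.*-zeroʳ t))) eq))
    ... | inj₁ e≡0 = e≢0 e≡0
    ... | inj₂ b≡0 = b≢0 b≡0
  ... | fin y | finite a≢0 eq = finite a≢0 (begin
    (ι t + ι e * y) * ι a           ≡⟨ distribute (ι t) (ι e) y (ι a) ⟩
    ι t * ι a + ι e * (y * ι a)     ≡⟨ cong (λ u → ι t * ι a + ι e * u) eq ⟩
    ι t * ι a + ι e * ι b           ≡⟨ cong₂ _+_ (sym (ι-* t a)) (sym (ι-* e b)) ⟩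
    ι (t ℤ.* a) + ι (e ℤ.* b)       ≡⟨ ι-+ (t ℤ.* a) (e ℤ.* b) ⟨
    ι (t ℤ.* a ℤ.+ e ℤ.* b)         ∎)
    where
    open ≡-Reasoning
    t = + (s ℕ.* v ℕ.* m)
    e = ε ℤ.* + (s ℕ.* s ℕ.* v)
    distribute : ∀ t e y a → (t + e * y) * a ≡ t * a + e * (y * a)
    distribute = solve-∀ ℚ-ring

  Rep-finite : ∀ {x a b} → Rep x a b → b ≢ 0ℤ → ∃ λ q → x ≡ fin q × q * ι b ≡ ι a
  Rep-finite (finite {q} _ eq) _ = q , refl , eq
  Rep-finite (infinite _ b≡0) b≢0 = ⊥-elim (b≢0 b≡0)

-- The recurrence for a_n: Pell-type identity and growth.

module Recurrence where

  open import Data.Integer hiding (suc)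
  open import Data.Integer.Properties
  open import Data.Integer.Tactic.RingSolver using (solve-∀)
  open IntegerLemmas

  vSeq-*-suc : ∀ v n → vSeq v n ℕ.* vSeq v (suc n) ≡ v
  vSeq-*-suc v zero = ℕ.*-identityʳ v
  vSeq-*-suc v (suc n) = trans (ℕ.*-comm (vSeq v (suc n)) (vSeq v n)) (vSeq-*-suc v n)

  vSeq-pos : ∀ {v} → 1 ℕ.≤ v → ∀ n → 1 ℕ.≤ vSeq v n
  vSeq-pos 1≤v zero = 1≤v
  vSeq-pos 1≤v (suc zero) = ℕ.≤-refl
  vSeq-pos 1≤v (suc (suc n)) = vSeq-pos 1≤v n

  -- This is (-ε)^n, the value of the quadratic form in `pell`.
  norm : ℤ → ℕ → ℤ
  norm ε zero = 1ℤ
  norm ε (suc n) = - ε * norm ε n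

  norm-±1 : ∀ {ε} → ε ≡ 1ℤ ⊎ ε ≡ -1ℤ → ∀ n → norm ε n ≡ 1ℤ ⊎ norm ε n ≡ -1ℤ
  norm-±1 _ zero = inj₁ refl
  norm-±1 (inj₁ refl) (suc n) with norm-±1 (inj₁ refl) n
  ... | inj₁ eq = inj₂ (cong (-1ℤ *_) eq)
  ... | inj₂ eq = inj₁ (cong (-1ℤ *_) eq)
  norm-±1 (inj₂ refl) (suc n) with norm-±1 (inj₂ refl) n
  ... | inj₁ eq = inj₁ (cong (1ℤ *_) eq)
  ... | inj₂ eq = inj₂ (cong (1ℤ *_) eq)

  module Sequences (v m : ℕ) (ε : ℤ) where

    V a : ℕ → ℤ
    V n = + vSeq v n
    a = aSeq v m ε

    V-*-suc : ∀ n → V n * V (suc n) ≡ + v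
    V-*-suc n = trans (sym (pos-* (vSeq v n) (vSeq v (suc n)))) (cong +_ (vSeq-*-suc v n))

    a-rec : ∀ n → a (suc (suc n)) ≡ V (suc n) * + m * a (suc n) + ε * a n
    a-rec n = cong (λ w → w * a (suc n) + ε * a n) (pos-* (vSeq v (suc n)) m)

    -- One step of the recurrence multiplies the form by -ε and exchanges `V n` and `V (suc n)`; the
    -- middle coefficient is unaffected because their product is always v.
    pell : ∀ n → V (suc n) * (a (suc n) * a (suc n)) - + v * + m * (a (suc n) * a n) - ε * V n * (a n * a n) ≡ norm ε n
    pell zero = id (+ v) (+ m) ε
      where
      id : ∀ v m ε → 1ℤ * (1ℤ * 1ℤ) - v * m * (1ℤ * 0ℤ) - ε * v * (0ℤ * 0ℤ) ≡ 1ℤ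
      id = solve-∀
    pell (suc n) = begin
      form (V n) (+ v) (V (suc n)) (a (suc (suc n))) (a (suc n))
        ≡⟨ cong₂ (λ w A → form (V n) w (V (suc n)) A (a (suc n))) (sym (V-*-suc n)) (a-rec n) ⟩
      form (V n) (V n * V (suc n)) (V (suc n)) (V (suc n) * + m * a (suc n) + ε * a n) (a (suc n))
        ≡⟨ id (V n) (V (suc n)) (+ m) ε (a (suc n)) (a n) ⟩
      - ε * form (V (suc n)) (V n * V (suc n)) (V n) (a (suc n)) (a n)
        ≡⟨ cong (λ w → - ε * form (V (suc n)) w (V n) (a (suc n)) (a n)) (V-*-suc n) ⟩
      - ε * form (V (suc n)) (+ v) (V n) (a (suc n)) (a n)
        ≡⟨ cong (- ε *_) (pell n) ⟩
      - ε * norm ε n ∎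
      where
      open ≡-Reasoning
      form : ℤ → ℤ → ℤ → ℤ → ℤ → ℤ
      form V₁ v V₀ a₁ a₀ = V₁ * (a₁ * a₁) - v * + m * (a₁ * a₀) - ε * V₀ * (a₀ * a₀)
      id : ∀ V₀ V₁ m ε a₁ a₀ →
        V₀ * ((V₁ * m * a₁ + ε * a₀) * (V₁ * m * a₁ + ε * a₀)) - V₀ * V₁ * m * ((V₁ * m * a₁ + ε * a₀) * a₁) - ε * V₁ * (a₁ * a₁)
        ≡ - ε * (V₁ * (a₁ * a₁) - V₀ * V₁ * m * (a₁ * a₀) - ε * V₀ * (a₀ * a₀))
      id = solve-∀

    1≤Vm : 1 ℕ.≤ v → 1 ℕ.≤ m → ∀ n → 1ℤ ≤ V n * + m
    1≤Vm 1≤v 1≤m n = subst (1ℤ ≤_) (pos-* (vSeq v n) m) (+≤+ (ℕ.*-mono-≤ (vSeq-pos 1≤v n) 1≤m))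

    -- `jump` makes a_n unbounded, and `half` selects the root d + √k instead of d - √k. Growth is
    -- measured over two steps because single steps can go down: for ε = -1, v = 5, m = 1 the
    -- sequence begins 0, 1, 1, 4, 3.
    record Growth (n : ℕ) : Set where
      field
        nonneg : 0ℤ ≤ a n
        jump   : a n + 1ℤ ≤ a (suc (suc n))
        -- equivalent to f_ξ^n(∞) ≥ d
        half   : V n * + m * a n ≤ + 2 * a (suc n)

  module GrowthPositive (v m : ℕ) (1≤v : 1 ℕ.≤ v) (1≤m : 1 ℕ.≤ m) where
    open Sequences v m 1ℤ

    signs : ∀ n → 0ℤ ≤ a n × 1ℤ ≤ a (suc n)
    signs zero = ≤-refl , ≤-refl
    signs (suc n) with signs n
    ... | 0≤a , 1≤a = ≤-trans 0≤1 1≤a , subst (1ℤ ≤_) (sym (a-rec n))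
      (≤-from-difference (id (V (suc n) * + m) (a (suc n)) (a n))
         (i≤j⇒0≤j-i (1≤Vm 1≤v 1≤m (suc n)) ⊗ (≤-trans 0≤1 1≤a) ⊕ i≤j⇒0≤j-i 1≤a ⊕ 0≤a))
      where
      id : ∀ w a₁ a₀ → w * a₁ + 1ℤ * a₀ - 1ℤ ≡ (w - 1ℤ) * a₁ + (a₁ - 1ℤ) + a₀
      id = solve-∀

    growth : ∀ n → Growth n
    growth n = record { nonneg = 0≤a n ; jump = jump ; half = half n }
      where
      0≤a = λ n → proj₁ (signs n)
      1≤a = λ n → proj₂ (signs n)
      jump : a n + 1ℤ ≤ a (suc (suc n))
      jump = subst (a n + 1ℤ ≤_) (sym (a-rec n))
        (≤-from-difference (id (V (suc n) * + m) (a (suc n)) (a n))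
           (i≤j⇒0≤j-i (1≤Vm 1≤v 1≤m (suc n)) ⊗ 0≤a (suc n) ⊕ i≤j⇒0≤j-i (1≤a n)))
        where
        id : ∀ w a₁ a₀ → w * a₁ + 1ℤ * a₀ - (a₀ + 1ℤ) ≡ (w - 1ℤ) * a₁ + (a₁ - 1ℤ)
        id = solve-∀
      half : ∀ n → V n * + m * a n ≤ + 2 * a (suc n)
      half zero = subst (_≤ + 2) (sym (*-zeroʳ (V 0 * + m))) (+≤+ ℕ.z≤n)
      half (suc n) = subst (λ A → V (suc n) * + m * a (suc n) ≤ + 2 * A) (sym (a-rec n))
        (≤-from-difference (id (V (suc n) * + m) (a (suc n)) (a n))
           (≤-trans 0≤1 (1≤Vm 1≤v 1≤m (suc n)) ⊗ 0≤a (suc n) ⊕ 0≤a n ⊕ 0≤a n))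
        where
        id : ∀ w a₁ a₀ → + 2 * (w * a₁ + 1ℤ * a₀) - w * a₁ ≡ w * a₁ + a₀ + a₀
        id = solve-∀

  module GrowthNegative (v m : ℕ) (1≤v : 1 ℕ.≤ v) (1≤m : 1 ℕ.≤ m) (5≤vm² : 5 ℕ.≤ v ℕ.* (m ℕ.* m)) where
    open Sequences v m -1ℤ

    5≤VVm² : ∀ n → + 5 ≤ V n * V (suc n) * (+ m * + m)
    5≤VVm² n = subst (+ 5 ≤_) (trans (pos-* v (m ℕ.* m)) (cong₂ _*_ (sym (V-*-suc n)) (pos-* m m))) (+≤+ 5≤vm²)

    jump : ∀ n → + 2 * a n + 1ℤ ≤ V (suc n) * + m * a (suc n) → a n + 1ℤ ≤ a (suc (suc n))
    jump n below = subst (a n + 1ℤ ≤_) (sym (a-rec n))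
      (≤-from-difference (id (V (suc n) * + m) (a (suc n)) (a n)) (i≤j⇒0≤j-i below))
      where
      id : ∀ w a₁ a₀ → w * a₁ + -1ℤ * a₀ - (a₀ + 1ℤ) ≡ w * a₁ - (+ 2 * a₀ + 1ℤ)
      id = solve-∀

    -- The third component is an invariant strong enough to reproduce itself. Substituted in the
    -- recurrence it yields `jump` at n and `half` at n + 1.
    below : ∀ n → 0ℤ ≤ a n × 1ℤ ≤ a (suc n) × + 2 * a n + 1ℤ ≤ V (suc n) * + m * a (suc n)
    below zero = ≤-refl , ≤-refl , subst (1ℤ ≤_) (sym (*-identityʳ (1ℤ * + m))) (1≤Vm 1≤v 1≤m 1)
    below (suc n) with below n
    ... | 0≤a , 1≤a , ih = ≤-trans 0≤1 1≤a , ≤-trans (+-monoˡ-≤ 1ℤ 0≤a) (jump n ih) ,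
      -- The inequality is doubled to split 2 v_n v_{n+1} m² a_{n+1} in two: one copy is at least 5
      -- a_{n+1} since vm² ≥ 5, and the other absorbs -2 v_n m a_n through `ih`.
      *-cancelˡ-≤-pos _ _ (+ 2) (≤-from-difference
        (trans (cong (λ A → + 2 * (V n * + m * A) - + 2 * (+ 2 * a (suc n) + 1ℤ)) (a-rec n))
               (id (V n) (V (suc n)) (+ m) (a (suc n)) (a n)))
        (i≤j⇒0≤j-i (5≤VVm² n) ⊗ ≤-trans 0≤1 1≤a ⊕ i≤j⇒0≤j-i 1≤a ⊕ i≤j⇒0≤j-i (1≤Vm 1≤v 1≤m n)
          ⊕ ≤-trans 0≤1 (1≤Vm 1≤v 1≤m n) ⊗ i≤j⇒0≤j-i ih))
      where
      id : ∀ V₀ V₁ m a₁ a₀ →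
        + 2 * (V₀ * m * (V₁ * m * a₁ + -1ℤ * a₀)) - + 2 * (+ 2 * a₁ + 1ℤ)
        ≡ (V₀ * V₁ * (m * m) - + 5) * a₁ + (a₁ - 1ℤ) + (V₀ * m - 1ℤ) + V₀ * m * (V₁ * m * a₁ - (+ 2 * a₀ + 1ℤ))
      id = solve-∀

    growth : ∀ n → Growth n
    growth n with below n
    ... | 0≤a , _ , b = record { nonneg = 0≤a ; jump = jump n b ; half = half n }
      where
      half : ∀ n → V n * + m * a n ≤ + 2 * a (suc n)
      half zero = subst (_≤ + 2) (sym (*-zeroʳ (V 0 * + m))) (+≤+ ℕ.z≤n)
      half (suc n) = subst (λ A → V (suc n) * + m * a (suc n) ≤ + 2 * A) (sym (a-rec n))
        (≤-from-difference (id (V (suc n) * + m) (a (suc n)) (a n))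
           (i≤j⇒0≤j-i (proj₂ (proj₂ (below n))) ⊕ 0≤1))
        where
        id : ∀ w a₁ a₀ → + 2 * (w * a₁ + -1ℤ * a₀) - w * a₁ ≡ w * a₁ - (+ 2 * a₀ + 1ℤ) + 1ℤ
        id = solve-∀

  growth : ∀ {v m ε} → 1 ℕ.≤ v → 1 ℕ.≤ m → ε ≡ 1ℤ ⊎ ε ≡ -1ℤ → ¬ (ε ≡ -1ℤ × v ℕ.* m ℕ.^ 2 ℕ.≤ 4) →
    ∀ n → Sequences.Growth v m ε n
  growth {v} {m} 1≤v 1≤m (inj₁ refl) _ = GrowthPositive.growth v m 1≤v 1≤m
  growth {v} {m} 1≤v 1≤m (inj₂ refl) large = GrowthNegative.growth v m 1≤v 1≤m
    (subst (λ k → 5 ℕ.≤ v ℕ.* (m ℕ.* k)) (ℕ.*-identityʳ m) (ℕ.≰⇒> (λ vm²≤4 → large (refl , vm²≤4))))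

-- The gcds s_n, the residues m_n and the iterates of f_ξ.

module GcdSequence where

  open import Data.Integer hiding (suc)
  open import Data.Integer.Properties
  open import Data.Integer.Divisibility.Signed
  open import Data.Integer.Tactic.RingSolver using (solve-∀)
  import Data.Integer.Coprimality as ℤ-Coprimality
  open IntegerLemmas
  open ProjectiveLine
  open Recurrence

  divℕ-≡ : ∀ a b .{{_ : ℕ.NonZero b}} → divℕ a b ≡ a ℕ./ b
  divℕ-≡ a (suc b) = refl

  divℤ-≡ : ∀ a b .{{_ : ℕ.NonZero b}} → divℤ (+ a) b ≡ + (a ℕ./ b)
  divℤ-≡ a (suc b) = refl

  module Arithmetic (s v m : ℕ) (ε : ℤ) (1≤s : 1 ℕ.≤ s) (1≤v : 1 ℕ.≤ v) (ε≡±1 : ε ≡ 1ℤ ⊎ ε ≡ -1ℤ)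
    (grow : ∀ n → Sequences.Growth v m ε n) where

    open Sequences v m ε public
    open module Growthₙ n = Growth (grow n) public

    ε²≡1 : ε * ε ≡ 1ℤ
    ε²≡1 = ±1⇒²≡1 ε≡±1

    S M : ℕ → ℕ
    S = sSeq s v m ε
    M = modulus s v m ε

    instance
      s≢0 : ℕ.NonZero s
      s≢0 = ℕ.>-nonZero 1≤s

    S≢0 : ∀ n → ℕ.NonZero (S n)
    S≢0 n = ℕ.≢-nonZero (gcd[m,n]≢0 ∣ a n ∣ s (inj₂ (ℕ.≢-nonZero⁻¹ s)))

    S*M : ∀ n → + S n * + M n ≡ + s
    S*M n = trans (sym (pos-* (S n) (M n))) (cong +_ (begin
      S n ℕ.* M n           ≡⟨ cong (S n ℕ.*_) (divℕ-≡ s (S n)) ⟩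
      S n ℕ.* (s ℕ./ S n)   ≡⟨ ℕ.*-comm (S n) _ ⟩
      (s ℕ./ S n) ℕ.* S n   ≡⟨ ℕ.m/n*n≡m (gcd[m,n]∣n ∣ a n ∣ s) ⟩
      s                     ∎))
      where
      open ≡-Reasoning
      instance _ = S≢0 n

    M≢0 : ∀ n → ℕ.NonZero (M n)
    M≢0 n = ℕ.≢-nonZero (λ M≡0 → ℕ.≢-nonZero⁻¹ s (+-injective
      (trans (sym (S*M n)) (trans (cong (λ k → + S n * + k) M≡0) (*-zeroʳ (+ S n))))))

    1≤S : ∀ n → 1ℤ ≤ + S n
    1≤S n = +≤+ (ℕ.>-nonZero⁻¹ (S n) {{S≢0 n}})

    1≤M : ∀ n → 1ℤ ≤ + M n
    1≤M n = +≤+ (ℕ.>-nonZero⁻¹ (M n) {{M≢0 n}})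

    S∣a : ∀ n → + S n ∣ a n
    S∣a n = ∣ᵤ⇒∣ (gcd[m,n]∣m ∣ a n ∣ s)

    S∣s : ∀ n → + S n ∣ + s
    S∣s n = ∣ᵤ⇒∣ (gcd[m,n]∣n ∣ a n ∣ s)

    S-greatest : ∀ n {d} → d ∣ a n → d ∣ + s → d ∣ + S n
    S-greatest n d∣a d∣s = ∣ᵤ⇒∣ (gcd-greatest (∣⇒∣ᵤ d∣a) (∣⇒∣ᵤ d∣s))

    divℤ-S : ∀ n → divℤ (a n) (S n) ≡ + ((∣ a n ∣ ℕ./ S n) {{S≢0 n}})
    divℤ-S n = trans (cong (λ x → divℤ x (S n)) (sym (0≤i⇒+∣i∣≡i (nonneg n)))) (divℤ-≡ ∣ a n ∣ (S n) {{S≢0 n}})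

    S*divℤ : ∀ n → + S n * divℤ (a n) (S n) ≡ a n
    S*divℤ n = begin
      + S n * divℤ (a n) (S n)           ≡⟨ cong (+ S n *_) (divℤ-S n) ⟩
      + S n * + (∣ a n ∣ ℕ./ S n)        ≡⟨ pos-* (S n) _ ⟨
      + (S n ℕ.* (∣ a n ∣ ℕ./ S n))      ≡⟨ cong +_ (trans (ℕ.*-comm (S n) _) (ℕ.m/n*n≡m (gcd[m,n]∣m ∣ a n ∣ s))) ⟩
      + ∣ a n ∣                          ≡⟨ 0≤i⇒+∣i∣≡i (nonneg n) ⟩
      a n                                ∎
      where
      open ≡-Reasoning
      instance _ = S≢0 n

    M-coprime : ∀ n → Coprime (M n) ∣ divℤ (a n) (S n) ∣
    M-coprime n = subst₂ Coprime (sym (divℕ-≡ s (S n))) (cong ∣_∣ (sym (divℤ-S n)))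
      (Coprimality.sym (coprime-/gcd ∣ a n ∣ s))
      where instance _ = S≢0 n

    module _ {mseq : ℕ → ℤ} (ismseq : IsMSeq s v m ε mseq) where

      -- `B` is the quotient a_{n+1}/s_{n+1}, which is invertible modulo s/s_{n+1}, so the
      -- congruence defining m_{n+1} has a single solution in the range.
      mseq-unique : ∀ n {t B} → + S (suc n) * B ≡ a (suc n) → 0ℤ ≤ t → t < + M (suc n) →
        + M (suc n) ∣ t * B + a n → t ≡ mseq (suc n)
      mseq-unique n {t} {B} SB≡a 0≤t t<M M∣ with ismseq (suc n)
      ... | 0≤μ , μ<M , M∣μ = residue-unique 0≤t t<M 0≤μ μ<M
        (∣ᵤ⇒∣ (ℤ-Coprimality.coprime-divisor (+ M (suc n)) B′ (t - μ) (M-coprime (suc n)) (∣⇒∣ᵤ M∣B′[t-μ])))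
        where
        μ = mseq (suc n)
        B′ = divℤ (a (suc n)) (S (suc n))
        B≡B′ : B ≡ B′
        B≡B′ = *-cancelˡ-≡ (+ S (suc n)) B B′ {{S≢0 (suc n)}} (trans SB≡a (sym (S*divℤ (suc n))))
        id : ∀ t μ B a → t * B + a - (μ * B - - a) ≡ B * (t - μ)
        id = solve-∀
        M∣B′[t-μ] : + M (suc n) ∣ B′ * (t - μ)
        M∣B′[t-μ] = subst (+ M (suc n) ∣_) (id t μ B′ (a n))
          (∣m∣n⇒∣m-n (subst (λ b → + M (suc n) ∣ t * b + a n) B≡B′ M∣) (∣ᵤ⇒∣ M∣μ))

    -- z₋ n = z_{n-1} and a₋ n = a_{n-1}, where a_{-1} = ε extends the recurrence to n = 0.
    z z₋ a₋ : ℕ → ℤ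
    z n = + s * V (suc n) * a (suc n)
    z₋ n = + s * V n * a n
    a₋ zero = ε
    a₋ (suc n) = a n

    -- Shifting the index swaps v and 1 among the coefficients, and the factor v_{n+1} in `z` undoes
    -- the swap. Hence `z` obeys the same recurrence as in `a-rec₋`, and both rows of the matrix can
    -- be treated alike.
    z-rec : ∀ n → z (suc n) ≡ V n * + m * z n + ε * z₋ n
    z-rec n = trans (cong (+ s * V n *_) (a-rec n)) (id (+ s) (V n) (V (suc n)) (+ m) ε (a (suc n)) (a n))
      where
      id : ∀ s V₀ V₁ m ε a₁ a₀ → s * V₀ * (V₁ * m * a₁ + ε * a₀) ≡ V₀ * m * (s * V₁ * a₁) + ε * (s * V₀ * a₀)
      id = solve-∀

    a-rec₋ : ∀ n → a (suc n) ≡ V n * + m * a n + ε * a₋ n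
    a-rec₋ zero = sym (cong₂ _+_ (*-zeroʳ (V 0 * + m)) ε²≡1)
    a-rec₋ (suc n) = a-rec n

    -- A regrouping of `pell` that exhibits consecutive terms as coprime, since `norm` is ±1.
    bezout : ∀ n → a (suc n) * (V (suc n) * a (suc n) - + v * + m * a n) + a n * (- (ε * V n * a n)) ≡ norm ε n
    bezout n = trans (id (V (suc n)) (V n) (+ v) (+ m) ε (a (suc n)) (a n)) (pell n)
      where
      id : ∀ V₁ V₀ v m ε a₁ a₀ → a₁ * (V₁ * a₁ - v * m * a₀) + a₀ * (- (ε * V₀ * a₀)) ≡
        V₁ * (a₁ * a₁) - v * m * (a₁ * a₀) - ε * V₀ * (a₀ * a₀)
      id = solve-∀

    -- Applying the matrix of f_ξ to (z_n, a_n) gives s v_{n+1} times (z_{n+1}, a_{n+1}), and the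
    -- common factor is cancelled at each step.
    iter-fXi : ∀ n → Rep (iter (fXi s v m ε) n ∞) (z n) (a n)
    iter-fXi zero = infinite (λ eq → ℕ.≢-nonZero⁻¹ s (+-injective (trans (sym (id (+ s))) eq))) refl
      where
      id : ∀ s → s * 1ℤ * 1ℤ ≡ s
      id = solve-∀
    iter-fXi (suc n) = Rep-unscale k k≢0
      (subst (λ x → Rep (iter (fXi s v m ε) (suc n) ∞) x (k * a (suc n))) eq (Rep-fXi s v m ε e≢0 (iter-fXi n)))
      where
      k = + s * V (suc n)
      k≢0 : k ≢ 0ℤ
      k≢0 = *-≢0 (1≤⇒≢0 (+≤+ 1≤s)) (1≤⇒≢0 (+≤+ (vSeq-pos 1≤v (suc n))))
      e≢0 : ε * + (s ℕ.* s ℕ.* v) ≢ 0ℤ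
      e≢0 = *-≢0 (±1⇒≢0 ε≡±1) (1≤⇒≢0 (+≤+ (ℕ.*-mono-≤ (ℕ.*-mono-≤ 1≤s 1≤s) 1≤v)))
      id : ∀ s V₀ V₁ m ε a₁ a₀ → s * (V₀ * V₁) * m * (s * V₁ * a₁) + ε * (s * s * (V₀ * V₁)) * a₀ ≡
        s * V₁ * (s * V₀ * (V₁ * m * a₁ + ε * a₀))
      id = solve-∀
      eq : + (s ℕ.* v ℕ.* m) * z n + ε * + (s ℕ.* s ℕ.* v) * a n ≡ k * z (suc n)
      eq = begin
        + (s ℕ.* v ℕ.* m) * z n + ε * + (s ℕ.* s ℕ.* v) * a n
          ≡⟨ cong₂ (λ x y → x * z n + ε * y * a n)
               (trans (pos-* (s ℕ.* v) m) (cong (_* + m) (pos-* s v)))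
               (trans (pos-* (s ℕ.* s) v) (cong (_* + v) (pos-* s s))) ⟩
        + s * + v * + m * z n + ε * (+ s * + s * + v) * a n
          ≡⟨ cong (λ w → + s * w * + m * z n + ε * (+ s * + s * w) * a n) (sym (V-*-suc n)) ⟩
        + s * (V n * V (suc n)) * + m * z n + ε * (+ s * + s * (V n * V (suc n))) * a n
          ≡⟨ id (+ s) (V n) (V (suc n)) (+ m) ε (a (suc n)) (a n) ⟩
        k * (+ s * V n * (V (suc n) * + m * a (suc n) + ε * a n))
          ≡⟨ cong (λ A → k * (+ s * V n * A)) (sym (a-rec n)) ⟩
        k * z (suc n) ∎
        where open ≡-Reasoning

-- The matrices of the blocks and their products.

module BlockMatrices where

  open import Data.Integer hiding (suc)
  open import Data.Integer.Properties
  open import Data.Integer.Divisibility.Signed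
  open import Data.Integer.Tactic.RingSolver using (solve-∀)
  open import Data.List.Properties using (upTo-∷ʳ; concatMap-++; ++-identityʳ)
  open import Data.Rational as ℚ using (ℚ)
  import Tactic.RingSolver as ℚ-Solver
  open IntegerLemmas
  open Continuants
  open Embedding
  open ProjectiveLine
  open Recurrence
  open GcdSequence

  δℤ : ℤ → ℤ
  δℤ (+ _) = 0ℤ
  δℤ -[1+ _ ] = 1ℤ

  ι-δℤ : ∀ ε → ι (δℤ ε) ≡ δ ε
  ι-δℤ (+ _) = refl
  ι-δℤ -[1+ _ ] = refl

  blocks-suc : ∀ (E : ℕ → List ℤ) n → blocks E (suc n) ≡ blocks E n ++ E n
  blocks-suc E n = begin
    blocks E (suc n)            ≡⟨ cong (concatMap E) (upTo-∷ʳ n) ⟨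
    concatMap E (upTo n ++ n ∷ []) ≡⟨ concatMap-++ E (upTo n) (n ∷ []) ⟩
    blocks E n ++ (E n ++ [])   ≡⟨ cong (blocks E n ++_) (++-identityʳ (E n)) ⟩
    blocks E n ++ E n           ∎
    where open ≡-Reasoning

  -- xs expands N/M, with the length parity prescribed by ε.
  record ReducedBlock (ε M N : ℤ) (xs : List ℤ) : Set where
    field
      cross      : num xs * M ≡ N * den xs
      unimod     : num xs * den′ xs - num′ xs * den xs ≡ - ε
      den-pos    : 1ℤ ≤ den xs
      den′-range : (ε ≡ 1ℤ × 0ℤ ≤ den′ xs × den′ xs + 1ℤ ≤ den xs) ⊎ (ε ≡ -1ℤ × 1ℤ ≤ den′ xs × den′ xs ≤ den xs)

  -- The denominators of the block are the numerators of its tail, which consists of positive terms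
  -- and has determinant ε. So ε = 1 puts the tail in the even case of `bounds` and ε = -1 in the
  -- odd one.
  reducedBlock : ∀ {ε} → ε ≡ 1ℤ ⊎ ε ≡ -1ℤ → ∀ {M N q xs} → q ℚ.* ι M ≡ ι N →
    IsCFExpansion q xs → RightParity ε (length xs) → ReducedBlock ε M N xs
  reducedBlock {ε} ε≡±1 {M} {N} {q} {xs@(c ∷ cs)} qM≡N (0<cs , cf≡q) parity = record
    { cross      = cross
    ; unimod     = trans (det xs) sgn≡
    ; den-pos    = num-pos 0<cs
    ; den′-range = range (bounds 0<cs)
    }
    where
    sgn≡ : sgn xs ≡ - ε
    sgn≡ = RightParity⇒sgn ε≡±1 xs parity
    q*den≡num : q ℚ.* ι (den xs) ≡ ι (num xs)
    q*den≡num = Rep-fin (subst (λ x → Rep x (num xs) (den xs)) cf≡q (Rep-cf xs))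
    cross : num xs * M ≡ N * den xs
    cross = ι-injective (begin
      ι (num xs * M)               ≡⟨ ι-* (num xs) M ⟩
      ι (num xs) ℚ.* ι M           ≡⟨ cong (ℚ._* ι M) q*den≡num ⟨
      q ℚ.* ι (den xs) ℚ.* ι M     ≡⟨ swap q (ι (den xs)) (ι M) ⟩
      q ℚ.* ι M ℚ.* ι (den xs)     ≡⟨ cong (ℚ._* ι (den xs)) qM≡N ⟩
      ι N ℚ.* ι (den xs)           ≡⟨ ι-* N (den xs) ⟨
      ι (N * den xs)               ∎)
      where
      open ≡-Reasoning
      swap : ∀ x y z → x ℚ.* y ℚ.* z ≡ x ℚ.* z ℚ.* y
      swap = ℚ-Solver.solve-∀ ℚ-ring
    sgn-cs : sgn cs ≡ ε
    sgn-cs = neg-injective sgn≡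
    range : (sgn cs ≡ 1ℤ × EvenBounds cs) ⊎ (sgn cs ≡ -1ℤ × OddBounds cs) →
      (ε ≡ 1ℤ × 0ℤ ≤ num′ cs × num′ cs + 1ℤ ≤ num cs) ⊎ (ε ≡ -1ℤ × 1ℤ ≤ num′ cs × num′ cs ≤ num cs)
    range (inj₁ (sgn≡1 , b)) = inj₁ (trans (sym sgn-cs) sgn≡1 , EvenBounds.num′-nonneg b , EvenBounds.num′<num b)
    range (inj₂ (sgn≡-1 , b)) = inj₂ (trans (sym sgn-cs) sgn≡-1 , OddBounds.num′-pos b , OddBounds.num′≤num b)

  module Blocks (s v m : ℕ) (ε : ℤ) (1≤s : 1 ℕ.≤ s) (1≤v : 1 ℕ.≤ v) (ε≡±1 : ε ≡ 1ℤ ⊎ ε ≡ -1ℤ)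
    (grow : ∀ n → Sequences.Growth v m ε n)
    {mseq : ℕ → ℤ} (ismseq : IsMSeq s v m ε mseq)
    {E : ℕ → List ℤ} (isblocks : IsBlocks s v m ε mseq E) where

    open Arithmetic s v m ε 1≤s 1≤v ε≡±1 grow public

    δₙ : ℕ → ℤ
    δₙ zero = 0ℤ
    δₙ (suc n) = δℤ ε

    -- The numerator of ξ̂_n - δ_n over the denominator s/s_n, in general not in lowest terms.
    N : ℕ → ℤ
    N n = + S n * V n * + m - ε * mseq n - δₙ n * + M n

    xiHat-* : ∀ n → xiHat s v m ε mseq n ℚ.* ι (+ M n) ≡ ι (+ S n * V n * + m - ε * mseq n)
    xiHat-* n = trans (frac-* _ (M n) {{M≢0 n}}) (cong (λ x → ι (x - ε * mseq n))
      (trans (pos-* (S n ℕ.* vSeq v n) m) (cong (_* + m) (pos-* (S n) (vSeq v n)))))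

    reduced : ∀ n → ReducedBlock ε (+ M n) (N n) (E n)
    reduced zero with isblocks zero
    ... | expansion , parity = reducedBlock ε≡±1
      (trans (xiHat-* 0) (cong ι (sym (id (+ S 0 * V 0 * + m - ε * mseq 0) (+ M 0))))) expansion parity
      where
      id : ∀ x M → x - 0ℤ * M ≡ x
      id = solve-∀
    reduced (suc n) with isblocks (suc n)
    ... | expansion , parity = reducedBlock ε≡±1 (begin
      (x ℚ.- δ ε) ℚ.* μ                 ≡⟨ distr x (δ ε) μ ⟩
      x ℚ.* μ ℚ.- δ ε ℚ.* μ             ≡⟨ cong₂ ℚ._-_ (xiHat-* (suc n)) (cong (ℚ._* μ) (sym (ι-δℤ ε))) ⟩
      ι y ℚ.- ι (δℤ ε) ℚ.* μ            ≡⟨ cong (λ w → ι y ℚ.- w) (sym (ι-* (δℤ ε) (+ M (suc n)))) ⟩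
      ι y ℚ.- ι w                       ≡⟨ ι-- y w ⟨
      ι (y - w)                         ∎) expansion parity
      where
      open ≡-Reasoning
      x = xiHat s v m ε mseq (suc n)
      μ = ι (+ M (suc n))
      y = + S (suc n) * V (suc n) * + m - ε * mseq (suc n)
      w = δℤ ε * + M (suc n)
      distr : ∀ x d μ → (x ℚ.- d) ℚ.* μ ≡ x ℚ.* μ ℚ.- d ℚ.* μ
      distr = ℚ-Solver.solve-∀ ℚ-ring

    record Row (n : ℕ) (T x z z₋ : ℤ) : Set where
      field
        first  : + S n * T ≡ z
        second : + M n * x ≡ ε * (mseq n * T + z₋) + δₙ n * + M n * T

    -- The contributions of m_n and δ_n to `N n` cancel those in `second`, leaving one step of the
    -- recurrence.
    combine : ∀ n {T x z z₋} → Row n T x z z₋ → N n * T + + M n * x ≡ V n * + m * z + ε * z₋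
    combine n {T} {x} {z} {z₋} row = begin
      N n * T + + M n * x
        ≡⟨ cong (λ w → N n * T + w) second ⟩
      N n * T + (ε * (mseq n * T + z₋) + δₙ n * + M n * T)
        ≡⟨ id (+ S n) (V n) (+ m) ε (mseq n) (δₙ n * + M n) T z₋ ⟩
      V n * + m * (+ S n * T) + ε * z₋
        ≡⟨ cong (λ w → V n * + m * w + ε * z₋) first ⟩
      V n * + m * z + ε * z₋ ∎
      where
      open ≡-Reasoning
      open Row row
      id : ∀ S V m ε μ d T z₋ → (S * V * m - ε * μ - d) * T + (ε * (μ * T + z₋) + d * T) ≡ V * m * (S * T) + ε * z₋
      id = solve-∀

    record Transition (n : ℕ) : Set where
      field
        N≡    : N n ≡ + S (suc n) * num (E n)
        M≡    : + M n ≡ + S (suc n) * den (E n)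
        M′≡   : + M (suc n) ≡ + S n * den (E n)
        den′≡ : + S n * den′ (E n) ≡ ε * mseq (suc n) + δℤ ε * + M (suc n)

    transition : ∀ n {B y} → Row n B y (a n) (a₋ n) → Transition n
    transition n {B} {y} row = record { N≡ = N≡ ; M≡ = M≡ ; M′≡ = M′≡ ; den′≡ = den′≡ }
      where
      open ReducedBlock (reduced n)
      open Row row
      P = num (E n)
      p = num′ (E n)
      Q = den (E n)
      q = den′ (E n)
      S₀ = + S n
      S₁ = + S (suc n)
      M₀ = + M n
      M₁ = + M (suc n)
      -ε²≡1 : - ε * - ε ≡ 1ℤ
      -ε²≡1 = trans (id ε) ε²≡1
        where
        id : ∀ ε → - ε * - ε ≡ ε * ε
        id = solve-∀
      open CommonFactor {P} {p} {Q} {q} {N n} {M₀} { - ε} -ε²≡1 unimod cross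

      NB+My≡a : N n * B + M₀ * y ≡ a (suc n)
      NB+My≡a = trans (combine n row) (sym (a-rec₋ n))

      a≡G*B₁ : a (suc n) ≡ G * (P * B + Q * y)
      a≡G*B₁ = trans (sym NB+My≡a) (trans (cong₂ (λ u w → u * B + w * y) N≡G*P M≡G*Q) (id G P Q B y))
        where
        id : ∀ G P Q B y → G * P * B + G * Q * y ≡ G * (P * B + Q * y)
        id = solve-∀

      -- The factor cancelled from N/M divides a_{n+1} by `a≡G*B₁`, and divides s because it divides
      -- `M₀`.
      G∣S₁ : G ∣ S₁
      G∣S₁ = S-greatest (suc n)
        (divides (P * B + Q * y) (trans a≡G*B₁ (*-comm G _)))
        (subst (G ∣_) (S*M n) (∣n⇒∣m*n S₀ (divides Q (trans M≡G*Q (*-comm G Q)))))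

      S₁∣a₁t : ∀ t → S₁ ∣ a (suc n) * t
      S₁∣a₁t t = ∣m⇒∣m*n t (S∣a (suc n))

      S₁-cancel : ∀ t → S₁ ∣ a n * t → S₁ ∣ t
      S₁-cancel t = coprime-cancel (V (suc n) * a (suc n) - + v * + m * a n) (- (ε * V n * a n)) (a (suc n)) (a n)
        (norm-±1 ε≡±1 n) (bezout n) (S₁∣a₁t t)

      S₁∣M₀ : S₁ ∣ M₀
      S₁∣M₀ = S₁-cancel M₀ (subst (S₁ ∣_) eq (∣m⇒∣m*n B (S∣s (suc n))))
        where
        id : ∀ S M B → S * M * B ≡ S * B * M
        id = solve-∀
        eq : + s * B ≡ a n * M₀
        eq = trans (cong (_* B) (sym (S*M n))) (trans (id S₀ M₀ B) (cong (_* M₀) first))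

      S₁∣N : S₁ ∣ N n
      S₁∣N = S₁-cancel (N n) (subst (S₁ ∣_) eq (∣m∣n⇒∣m-n (S₁∣a₁t S₀) (∣m⇒∣m*n y (S∣s (suc n)))))
        where
        id : ∀ N B M y S → (N * B + M * y) * S - S * M * y ≡ S * B * N
        id = solve-∀
        eq : a (suc n) * S₀ - + s * y ≡ a n * N n
        eq = trans (cong₂ (λ u w → u * S₀ - w * y) (sym NB+My≡a) (sym (S*M n)))
                   (trans (id (N n) B M₀ y S₀) (cong (_* N n) first))

      0<G : 0ℤ < G
      0<G = positive-factor (≤-trans 0≤1 den-pos) (subst (0ℤ <_) M≡G*Q (suc[i]≤j⇒i<j (1≤M n)))

      G≡S₁ : G ≡ S₁
      G≡S₁ = ∣-antisym-pos (<⇒≤ 0<G) (≤-trans 0≤1 (1≤S (suc n))) G∣S₁ (G-greatest S₁∣N S₁∣M₀)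

      N≡ : N n ≡ S₁ * P
      N≡ = trans N≡G*P (cong (_* P) G≡S₁)

      M≡ : M₀ ≡ S₁ * Q
      M≡ = trans M≡G*Q (cong (_* Q) G≡S₁)

      M′≡ : M₁ ≡ S₀ * Q
      M′≡ = *-cancelˡ-≡ S₁ M₁ (S₀ * Q) {{S≢0 (suc n)}}
        (trans (S*M (suc n)) (trans (sym (S*M n)) (trans (cong (S₀ *_) M≡) (id S₀ S₁ Q))))
        where
        id : ∀ x y z → x * (y * z) ≡ y * (x * z)
        id = solve-∀

      -- `t` is what `den′≡` requires m_{n+1} to be: s_n q for ε = 1 and s_n (Q - q) for ε = -1. It
      -- is identified with m_{n+1} by checking the range, from the bounds on q, and the congruence,
      -- from the determinant.
      B₁ t : ℤ
      B₁ = P * B + Q * y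
      t = ε * (S₀ * q - δℤ ε * M₁)

      S₁B₁≡a : S₁ * B₁ ≡ a (suc n)
      S₁B₁≡a = trans (cong (_* B₁) (sym G≡S₁)) (sym a≡G*B₁)

      Sq<SQ : ∀ q r → q + 1ℤ ≤ r → S₀ * q + 1ℤ ≤ S₀ * r
      Sq<SQ q r q<r = ≤-from-difference (id S₀ q r) (≤-trans 0≤1 (1≤S n) ⊗ i≤j⇒0≤j-i q<r ⊕ i≤j⇒0≤j-i (1≤S n))
        where
        id : ∀ S q r → S * r - (S * q + 1ℤ) ≡ S * (r - (q + 1ℤ)) + (S - 1ℤ)
        id = solve-∀

      in-range : 0ℤ ≤ t × t + 1ℤ ≤ M₁
      in-range with den′-range
      ... | inj₁ (refl , 0≤q , q<Q) =
        subst (0ℤ ≤_) (sym t≡) (≤-trans 0≤1 (1≤S n) ⊗ 0≤q) ,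
        subst₂ (λ u w → u + 1ℤ ≤ w) (sym t≡) (sym M′≡) (Sq<SQ q Q q<Q)
        where
        id : ∀ S q M → 1ℤ * (S * q - 0ℤ * M) ≡ S * q
        id = solve-∀
        t≡ : t ≡ S₀ * q
        t≡ = id S₀ q M₁
      ... | inj₂ (refl , 1≤q , q≤Q) =
        subst (0ℤ ≤_) (sym t≡) (≤-trans 0≤1 (1≤S n) ⊗ i≤j⇒0≤j-i q≤Q) ,
        subst₂ (λ u w → u + 1ℤ ≤ w) (sym t≡) (sym M′≡)
          (Sq<SQ (Q - q) Q (≤-from-difference (id′ Q q) (i≤j⇒0≤j-i 1≤q)))
        where
        id : ∀ S q Q → -1ℤ * (S * q - 1ℤ * (S * Q)) ≡ S * (Q - q)
        id = solve-∀
        id′ : ∀ Q q → Q - (Q - q + 1ℤ) ≡ q - 1ℤ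
        id′ = solve-∀
        t≡ : t ≡ S₀ * (Q - q)
        t≡ = trans (cong (λ w → -1ℤ * (S₀ * q - 1ℤ * w)) M′≡) (id S₀ q Q)

      -- The determinant -ε makes `q * B₁` congruent to -εB modulo `Q`. Multiplied by ε s_n, this
      -- becomes the congruence for m_{n+1} modulo s_n Q = s/s_{n+1}.
      qB₁≡ : q * B₁ ≡ Q * (p * B + q * y) - ε * B
      qB₁≡ = trans (id₁ P p Q q B y)
        (trans (cong (λ w → Q * (p * B + q * y) + w * B) unimod) (id₂ (Q * (p * B + q * y)) ε B))
        where
        id₁ : ∀ P p Q q B y → q * (P * B + Q * y) ≡ Q * (p * B + q * y) + (P * q - p * Q) * B
        id₁ = solve-∀
        id₂ : ∀ x ε B → x + - ε * B ≡ x - ε * B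
        id₂ = solve-∀

      M₁∣ : M₁ ∣ t * B₁ + a n
      M₁∣ = divides (ε * (p * B + q * y) - ε * δℤ ε * B₁) (begin
        ε * (S₀ * q - δℤ ε * M₁) * B₁ + a n
          ≡⟨ cong (λ w → ε * (S₀ * q - δℤ ε * M₁) * B₁ + w) first ⟨
        ε * (S₀ * q - δℤ ε * M₁) * B₁ + S₀ * B
          ≡⟨ id₁ ε S₀ q (δℤ ε) M₁ B₁ B ⟩
        ε * S₀ * (q * B₁) + S₀ * B - ε * δℤ ε * B₁ * M₁
          ≡⟨ cong (λ w → ε * S₀ * w + S₀ * B - ε * δℤ ε * B₁ * M₁) qB₁≡ ⟩
        ε * S₀ * (Q * (p * B + q * y) - ε * B) + S₀ * B - ε * δℤ ε * B₁ * M₁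
          ≡⟨ id₂ ε S₀ Q (p * B + q * y) B (ε * δℤ ε * B₁ * M₁) ⟩
        ε * (p * B + q * y) * (S₀ * Q) + S₀ * B - ε * ε * (S₀ * B) - ε * δℤ ε * B₁ * M₁
          ≡⟨ cong₂ (λ u w → ε * (p * B + q * y) * u + S₀ * B - w * (S₀ * B) - ε * δℤ ε * B₁ * M₁) (sym M′≡) ε²≡1 ⟩
        ε * (p * B + q * y) * M₁ + S₀ * B - 1ℤ * (S₀ * B) - ε * δℤ ε * B₁ * M₁
          ≡⟨ id₃ (ε * (p * B + q * y)) M₁ (S₀ * B) (ε * δℤ ε * B₁) ⟩
        (ε * (p * B + q * y) - ε * δℤ ε * B₁) * M₁ ∎)
        where
        open ≡-Reasoning
        id₁ : ∀ ε S q d M B₁ B → ε * (S * q - d * M) * B₁ + S * B ≡ ε * S * (q * B₁) + S * B - ε * d * B₁ * M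
        id₁ = solve-∀
        id₂ : ∀ ε S Q Y B W → ε * S * (Q * Y - ε * B) + S * B - W ≡ ε * Y * (S * Q) + S * B - ε * ε * (S * B) - W
        id₂ = solve-∀
        id₃ : ∀ Y M X W → Y * M + X - 1ℤ * X - W * M ≡ (Y - W) * M
        id₃ = solve-∀

      t≡μ : t ≡ mseq (suc n)
      t≡μ = mseq-unique ismseq n S₁B₁≡a (proj₁ in-range)
        (suc[i]≤j⇒i<j (subst (_≤ M₁) (+-comm t 1ℤ) (proj₂ in-range))) M₁∣

      den′≡ : S₀ * q ≡ ε * mseq (suc n) + δℤ ε * M₁
      den′≡ = sym (begin
        ε * mseq (suc n) + δℤ ε * M₁                     ≡⟨ cong (λ w → ε * w + δℤ ε * M₁) t≡μ ⟨
        ε * (ε * (S₀ * q - δℤ ε * M₁)) + δℤ ε * M₁       ≡⟨ id₁ ε (S₀ * q) (δℤ ε * M₁) ⟩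
        ε * ε * (S₀ * q - δℤ ε * M₁) + δℤ ε * M₁         ≡⟨ cong (λ w → w * (S₀ * q - δℤ ε * M₁) + δℤ ε * M₁) ε²≡1 ⟩
        1ℤ * (S₀ * q - δℤ ε * M₁) + δℤ ε * M₁            ≡⟨ id₂ (S₀ * q) (δℤ ε * M₁) ⟩
        S₀ * q                                           ∎)
        where
        open ≡-Reasoning
        id₁ : ∀ ε x y → ε * (ε * (x - y)) + y ≡ ε * ε * (x - y) + y
        id₁ = solve-∀
        id₂ : ∀ x y → 1ℤ * (x - y) + y ≡ x
        id₂ = solve-∀

    -- Right multiplication by the matrix of `E n`, for any solution of the recurrence. `first` is
    -- `combine` after the reduction of N and M; for `second`, the determinant trades
    -- `Q * (T * p + x * q)` for `q` times the new first entry.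
    Row-step : ∀ n {T x z z₋ z₊} → Transition n → z₊ ≡ V n * + m * z + ε * z₋ → Row n T x z z₋ →
      Row (suc n) (T * num (E n) + x * den (E n)) (T * num′ (E n) + x * den′ (E n)) z₊ z
    Row-step n {T} {x} {z} {z₋} tr z₊≡ row = record
      { first = begin
          S₁ * (T * P + x * Q)               ≡⟨ id₁ S₁ T P x Q ⟩
          S₁ * P * T + S₁ * Q * x            ≡⟨ cong₂ (λ u w → u * T + w * x) (sym N≡) (sym M≡) ⟩
          N n * T + + M n * x                ≡⟨ combine n row ⟩
          V n * + m * z + ε * z₋             ≡⟨ z₊≡ ⟨
          _                                  ∎
      ; second = begin
          M₁ * (T * p + x * q)                               ≡⟨ cong (_* (T * p + x * q)) M′≡ ⟩
          S₀ * Q * (T * p + x * q)                           ≡⟨ id₂ S₀ T P p x Q q ⟩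
          S₀ * q * T₁ - S₀ * T * (P * q - p * Q)             ≡⟨ cong₂ (λ u w → u * T₁ - S₀ * T * w) den′≡ unimod ⟩
          (ε * μ + δℤ ε * M₁) * T₁ - S₀ * T * - ε            ≡⟨ cong (λ w → (ε * μ + δℤ ε * M₁) * T₁ - w * - ε) first ⟩
          (ε * μ + δℤ ε * M₁) * T₁ - z * - ε                 ≡⟨ id₃ ε μ (δℤ ε * M₁) T₁ z ⟩
          ε * (μ * T₁ + z) + δℤ ε * M₁ * T₁                  ∎
      }
      where
      open ≡-Reasoning
      open Transition tr
      open Row row
      open ReducedBlock (reduced n)
      P = num (E n)
      p = num′ (E n)
      Q = den (E n)
      q = den′ (E n)
      S₀ = + S n
      S₁ = + S (suc n)
      M₁ = + M (suc n)
      μ = mseq (suc n)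
      T₁ = T * P + x * Q
      id₁ : ∀ S T P x Q → S * (T * P + x * Q) ≡ S * P * T + S * Q * x
      id₁ = solve-∀
      id₂ : ∀ S T P p x Q q → S * Q * (T * p + x * q) ≡ S * q * (T * P + x * Q) - S * T * (P * q - p * Q)
      id₂ = solve-∀
      id₃ : ∀ ε μ D T z → (ε * μ + D) * T - z * - ε ≡ ε * (μ * T + z) + D * T
      id₃ = solve-∀

    D : ℕ → List ℤ
    D = blocks E

    record Rows (n : ℕ) : Set where
      field
        top    : Row n (num (D n)) (num′ (D n)) (z n) (z₋ n)
        bottom : Row n (den (D n)) (den′ (D n)) (a n) (a₋ n)

    S₀≡s : + S 0 ≡ + s
    S₀≡s = cong +_ (gcd-identityˡ s)

    M₀≡1 : + M 0 ≡ 1ℤ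
    M₀≡1 = *-cancelˡ-≡ (+ s) (+ M 0) 1ℤ
      (trans (cong (_* + M 0) (sym S₀≡s)) (trans (S*M 0) (sym (*-identityʳ (+ s)))))

    mseq₀≡0 : mseq 0 ≡ 0ℤ
    mseq₀≡0 with ismseq 0
    ... | 0≤μ , μ<M , _ = ≤-antisym (i<j⇒i≤pred[j] (subst (mseq 0 <_) M₀≡1 μ<M)) 0≤μ

    rows : ∀ n → Rows n
    rows zero = record
      { top = record
        { first  = trans (cong (_* 1ℤ) S₀≡s) (id₁ (+ s))
        ; second = trans (id₂ (+ M 0) (+ s) (V 0) ε) (cong (λ μ → ε * (μ * 1ℤ + z₋ 0) + 0ℤ * + M 0 * 1ℤ) (sym mseq₀≡0))
        }
      ; bottom = record
        { first  = *-zeroʳ (+ S 0)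
        ; second = trans (cong (_* 1ℤ) M₀≡1) (trans (sym ε²≡1) (id₃ ε (mseq 0) (+ M 0)))
        }
      }
      where
      id₁ : ∀ s → s * 1ℤ ≡ s * 1ℤ * 1ℤ
      id₁ = solve-∀
      id₂ : ∀ M s V ε → M * 0ℤ ≡ ε * (0ℤ * 1ℤ + s * V * 0ℤ) + 0ℤ * M * 1ℤ
      id₂ = solve-∀
      id₃ : ∀ ε μ M → ε * ε ≡ ε * (μ * 0ℤ + ε) + 0ℤ * M * 0ℤ
      id₃ = solve-∀
    rows (suc n) = record
      { top = subst₂ (λ T x → Row (suc n) T x (z (suc n)) (z₋ (suc n)))
          (sym (trans (cong num (blocks-suc E n)) (num-++ (D n) (E n))))
          (sym (trans (cong num′ (blocks-suc E n)) (num′-++ (D n) (E n))))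
          (Row-step n tr (z-rec n) top)
      ; bottom = subst₂ (λ T x → Row (suc n) T x (a (suc n)) (a₋ (suc n)))
          (sym (trans (cong den (blocks-suc E n)) (den-++ (D n) (E n))))
          (sym (trans (cong den′ (blocks-suc E n)) (den′-++ (D n) (E n))))
          (Row-step n tr (a-rec₋ n) bottom)
      }
      where
      open Rows (rows n)
      -- The bottom row alone determines the transition, which then serves both rows.
      tr = transition n bottom

    cf-blocks : ∀ n → cf (blocks E n) ≡ iter (fXi s v m ε) n ∞
    cf-blocks n = Rep-unique (Rep-cf (D n))
      (Rep-unscale (+ S n) (1≤⇒≢0 (1≤S n))
        (subst₂ (Rep _) (sym (Row.first top)) (sym (Row.first bottom)) (iter-fXi n)))
      where open Rows (rows n)

-- Truncations as complete blocks followed by a prefix of a block.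

module Truncations where

  open import Data.Nat
  open import Data.Nat.Properties
  open import Data.Integer using (+_)
  open import Data.List.Properties using (length-++; map-upTo; ++-identityʳ; ++-assoc)
  open BlockMatrices using (blocks-suc)

  module _ {A : Set} where

    take-++-≤ : ∀ {l} (xs ys : List A) → l ≤ length xs → take l (xs ++ ys) ≡ take l xs
    take-++-≤ {zero} xs ys _ = refl
    take-++-≤ {suc l} (x ∷ xs) ys (s≤s l≤) = cong (x ∷_) (take-++-≤ xs ys l≤)

    take-++-+ : ∀ (xs ys : List A) k → take (length xs + k) (xs ++ ys) ≡ xs ++ take k ys
    take-++-+ [] ys k = refl
    take-++-+ (x ∷ xs) ys k = cong (x ∷_) (take-++-+ xs ys k)

  nthOr-++ : ∀ d xs ys {i} → i < length xs → nthOr d (xs ++ ys) i ≡ nthOr d xs i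
  nthOr-++ d (x ∷ xs) ys {zero} _ = refl
  nthOr-++ d (x ∷ xs) ys {suc i} (s≤s i<) = nthOr-++ d xs ys i<

  applyUpTo-nthOr : ∀ d xs {l} (f : ℕ → ℤ) → l ≤ length xs → (∀ {i} → i < l → f i ≡ nthOr d xs i) → applyUpTo f l ≡ take l xs
  applyUpTo-nthOr d xs {zero} f _ _ = refl
  applyUpTo-nthOr d (x ∷ xs) {suc l} f (s≤s l≤) f≡ =
    cong₂ _∷_ (f≡ (s≤s z≤n)) (applyUpTo-nthOr d xs (f ∘ suc) l≤ (λ i<l → f≡ (s≤s i<l)))

  module Truncation (E : ℕ → List ℤ) (nonempty : ∀ n → 1 ≤ length (E n)) where

    length-blocks-suc : ∀ n → length (blocks E (suc n)) ≡ length (blocks E n) + length (E n)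
    length-blocks-suc n = trans (cong length (blocks-suc E n)) (length-++ (blocks E n))

    n≤length-blocks : ∀ n → n ≤ length (blocks E n)
    n≤length-blocks zero = z≤n
    n≤length-blocks (suc n) = begin
      suc n                                   ≡⟨ +-comm 1 n ⟩
      n + 1                                   ≤⟨ +-mono-≤ (n≤length-blocks n) (nonempty n) ⟩
      length (blocks E n) + length (E n)      ≡⟨ length-blocks-suc n ⟨
      length (blocks E (suc n))               ∎
      where open ≤-Reasoning

    blocks-+ : ∀ n k → ∃ λ ys → blocks E (k + n) ≡ blocks E n ++ ys
    blocks-+ n zero = [] , sym (++-identityʳ (blocks E n))
    blocks-+ n (suc k) with blocks-+ n k
    ... | ys , eq = ys ++ E (k + n) ,
      trans (blocks-suc E (k + n)) (trans (cong (_++ E (k + n)) eq) (++-assoc (blocks E n) ys (E (k + n))))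

    blocks-≤ : ∀ {n n′} → n ≤ n′ → ∃ λ ys → blocks E n′ ≡ blocks E n ++ ys
    blocks-≤ {n} {n′} n≤n′ = subst (λ l → ∃ λ ys → blocks E l ≡ blocks E n ++ ys) (m∸n+n≡m n≤n′) (blocks-+ n (n′ ∸ n))

    length-blocks-mono : ∀ {n n′} → n ≤ n′ → length (blocks E n) ≤ length (blocks E n′)
    length-blocks-mono {n} n≤n′ with blocks-≤ n≤n′
    ... | ys , eq = subst (length (blocks E n) ≤_) (sym (trans (cong length eq) (length-++ (blocks E n)))) (m≤m+n _ _)

    -- Each term is looked up in a different concatenation; these are prefixes of one another, so
    -- all lookups can be made in the longest.
    terms : ∀ j → map (cTerm E) (upTo (suc j)) ≡ take (suc j) (blocks E (suc j))
    terms j = trans (map-upTo (cTerm E) (suc j))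
      (applyUpTo-nthOr (+ 0) (blocks E (suc j)) (cTerm E) (n≤length-blocks (suc j)) stable)
      where
      stable : ∀ {i} → i < suc j → cTerm E i ≡ nthOr (+ 0) (blocks E (suc j)) i
      stable {i} i<1+j with blocks-≤ i<1+j
      ... | ys , eq = sym (trans (cong (λ xs → nthOr (+ 0) xs i) eq)
                                 (nthOr-++ (+ 0) (blocks E (suc i)) ys (n≤length-blocks (suc i))))

    -- Blocks are dropped from the end until the cut falls in the last one. At least one term of
    -- that block is kept, because the empty prefix has `den` equal to 0.
    split : ∀ n₀ N {l} → length (blocks E n₀) < l → l ≤ length (blocks E N) →
      ∃₂ λ n k → n₀ ≤ n × take l (blocks E N) ≡ blocks E n ++ take (suc k) (E n)
    split n₀ zero n₀<l l≤0 = ⊥-elim (<⇒≱ n₀<l (≤-trans l≤0 z≤n))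
    split n₀ (suc N) {l} n₀<l l≤ with l ≤? length (blocks E N)
    ... | yes l≤N with split n₀ N n₀<l l≤N
    ...   | n , k , n₀≤n , eq = n , k , n₀≤n ,
      trans (cong (take l) (blocks-suc E N)) (trans (take-++-≤ (blocks E N) (E N) l≤N) eq)
    split n₀ (suc N) {l} n₀<l l≤ | no l≰N with m<n⇒∃[o]m+o≡n (≰⇒> l≰N)
      where
      m<n⇒∃[o]m+o≡n : ∀ {m n} → m < n → ∃ λ o → n ≡ m + suc o
      m<n⇒∃[o]m+o≡n {m} {n} m<n = n ∸ suc m , sym (trans (+-suc m (n ∸ suc m)) (m+[n∸m]≡n m<n))
    ... | k , l≡ = N , k , ≮⇒≥ N≮n₀ ,
      trans (cong₂ take l≡ (blocks-suc E N)) (take-++-+ (blocks E N) (E N) (suc k))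
      where
      N≮n₀ : N ≮ n₀
      N≮n₀ N<n₀ = <⇒≱ n₀<l (≤-trans l≤ (length-blocks-mono N<n₀))

    truncation-split : ∀ n₀ j → length (blocks E n₀) ≤ j →
      ∃₂ λ n k → n₀ ≤ n × map (cTerm E) (upTo (suc j)) ≡ blocks E n ++ take (suc k) (E n)
    truncation-split n₀ j n₀≤j with split n₀ (suc j) {suc j} (s≤s n₀≤j) (n≤length-blocks (suc j))
    ... | n , k , n₀≤n , eq = n , k , n₀≤n , trans (terms j) eq

-- Error estimates and convergence to ξ.

module Limit where

  open import Data.Integer hiding (suc)
  open import Data.Integer.Properties
  open import Data.Integer.Divisibility.Signed
  open import Data.Integer.Tactic.RingSolver using (solve-∀)
  open import Data.Rational as ℚ using (ℚ; 0ℚ)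
  import Data.Rational.Properties as ℚ
  import Tactic.RingSolver as ℚ-Solver
  open IntegerLemmas
  open Continuants
  open Embedding
  open RationalOrder using (sqrt-window; archimedean)
  open ProjectiveLine
  open Recurrence
  open BlockMatrices
  open Truncations

  module Convergence (s v m : ℕ) (ε : ℤ) (1≤s : 1 ℕ.≤ s) (1≤v : 1 ℕ.≤ v) (ε≡±1 : ε ≡ 1ℤ ⊎ ε ≡ -1ℤ)
    (grow : ∀ n → Sequences.Growth v m ε n)
    {mseq : ℕ → ℤ} (ismseq : IsMSeq s v m ε mseq)
    {E : ℕ → List ℤ} (isblocks : IsBlocks s v m ε mseq E) where

    open Blocks s v m ε 1≤s 1≤v ε≡±1 grow ismseq isblocks

    n≤2a : ∀ n → + n ≤ + 2 * a n
    n≤2a zero = ≤-refl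
    n≤2a (suc zero) = +≤+ (ℕ.s≤s ℕ.z≤n)
    n≤2a (suc (suc n)) = ≤-from-difference (id (+ n) (a n) (a (suc (suc n))))
      (i≤j⇒0≤j-i (n≤2a n) ⊕ +≤+ (ℕ.z≤n {2}) ⊗ i≤j⇒0≤j-i (jump n))
      where
      id : ∀ n a₀ a₂ → + 2 * a₂ - (+ 2 + n) ≡ (+ 2 * a₀ - n) + + 2 * (a₂ - (a₀ + 1ℤ))
      id = solve-∀

    -- s_{n+1} Q = s/s_n, so the reduced denominator divides s.
    den-E≤s : ∀ n → den (E n) ≤ + s
    den-E≤s n = begin
      den (E n)                             ≤⟨ ≤-*ˡ (1≤S (suc n)) 0≤Q ⟩
      + S (suc n) * den (E n)               ≡⟨ M≡ ⟨
      + M n                                 ≤⟨ ≤-*ˡ (1≤S n) (≤-trans 0≤1 (1≤M n)) ⟩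
      + S n * + M n                         ≡⟨ S*M n ⟩
      + s                                   ∎
      where
      open ≤-Reasoning
      open Transition (transition n (Rows.bottom (rows n)))
      0≤Q = ≤-trans 0≤1 (ReducedBlock.den-pos (reduced n))

    s<den : ∀ n → + (s ℕ.* s) < a n → + s < den (D n)
    s<den n s²<a = *-cancelˡ-<-nonNeg (+ s) (begin-strict
      + s * + s          ≡⟨ pos-* s s ⟨
      + (s ℕ.* s)        <⟨ s²<a ⟩
      a n                ≡⟨ SB≡a ⟨
      + S n * B          ≤⟨ *-monoʳ-≤-nonNeg B {{nonNegative 0≤B}} (+≤+ (gcd[m,n]≤n ∣ a n ∣ s)) ⟩
      + s * B            ∎)
      where
      open ≤-Reasoning
      B = den (D n)
      SB≡a = Row.first (Rows.bottom (rows n))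
      0≤B : 0ℤ ≤ B
      0≤B = <⇒≤ (positive-factor (≤-trans 0≤1 (1≤S n))
        (subst (0ℤ <_) (trans (sym SB≡a) (*-comm (+ S n) B)) (≤-<-trans (+≤+ ℕ.z≤n) s²<a)))

    module Prefix (n k : ℕ) (s<B : + s < den (D n)) where

      pre : List ℤ
      pre = take (suc k) (E n)

      T B U W q σ : ℤ
      T = num (D n)
      B = den (D n)
      U = num (D n ++ pre)
      W = den (D n ++ pre)
      q = den pre
      σ = sgn (D n)

      1≤q : 1ℤ ≤ q
      1≤q = proj₁ (den-prefix (E n) (proj₁ (isblocks n)) k)

      q≤s : q ≤ + s
      q≤s = ≤-trans (proj₂ (den-prefix (E n) (proj₁ (isblocks n)) k)) (den-E≤s n)

      0≤B : 0ℤ ≤ B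
      0≤B = <⇒≤ (≤-<-trans (+≤+ ℕ.z≤n) s<B)

      B≢0 : B ≢ 0ℤ
      B≢0 B≡0 = <⇒≢ (≤-<-trans (+≤+ ℕ.z≤n) s<B) (sym B≡0)

      -- The numerator of U/W - T/B. The multiple of the first column of D_n contained in (U, W)
      -- drops out, leaving `q` times the determinant up to sign.
      UB-TW : U * B - T * W ≡ - σ * q
      UB-TW = trans (cong₂ (λ u w → u * B - T * w) (num-++ (D n) pre) (den-++ (D n) pre))
        (trans (id T (num′ (D n)) B (den′ (D n)) (num pre) q) (cong (λ d → - d * q) (det (D n))))
        where
        id : ∀ T x B y p q → (T * p + x * q) * B - T * (B * p + y * q) ≡ - (T * y - x * B) * q
        id = solve-∀

      W≢0 : W ≢ 0ℤ
      W≢0 W≡0 = <⇒≱ s<B (≤-trans B≤q q≤s)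
        where
        q≡ : q ≡ - σ * U * B
        q≡ = begin
          q                            ≡⟨ *-identityˡ q ⟨
          1ℤ * q                       ≡⟨ cong (_* q) (±1⇒²≡1 (sgn-±1 (D n))) ⟨
          σ * σ * q                    ≡⟨ id₁ σ q ⟩
          - σ * (- σ * q)              ≡⟨ cong (- σ *_) UB-TW ⟨
          - σ * (U * B - T * W)        ≡⟨ cong (λ w → - σ * (U * B - T * w)) W≡0 ⟩
          - σ * (U * B - T * 0ℤ)       ≡⟨ id₂ σ U B T ⟩
          - σ * U * B                  ∎
          where
          open ≡-Reasoning
          id₁ : ∀ σ q → σ * σ * q ≡ - σ * (- σ * q)
          id₁ = solve-∀
          id₂ : ∀ σ U B T → - σ * (U * B - T * 0ℤ) ≡ - σ * U * B
          id₂ = solve-∀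
        B≤q : B ≤ q
        B≤q = subst₂ _≤_ (0≤i⇒+∣i∣≡i 0≤B) (0≤i⇒+∣i∣≡i (≤-trans 0≤1 1≤q))
          (+≤+ (ℕ.∣⇒≤ {{≢-nonZero (1≤⇒≢0 1≤q)}} (∣⇒∣ᵤ (divides (- σ * U) q≡))))

      -- |X - Y| = q/|WB| ≤ s/B because |W| ≥ 1 and q ≤ s. Clearing a_n = s_n B instead of `B`
      -- expresses the bound in the quantity whose growth is known.
      distance : ∀ {X Y} → X ℚ.* ι W ≡ ι U → Y ℚ.* ι B ≡ ι T → ℚ.∣ X ℚ.- Y ∣ ℚ.* ι (a n) ℚ.≤ ι (+ (s ℕ.* s))
      distance {X} {Y} XW≡U YB≡T = begin
        e ℚ.* ι (a n)                   ≡⟨ cong (e ℚ.*_) (trans (cong ι (sym (Row.first (Rows.bottom (rows n))))) (ι-* (+ S n) B)) ⟩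
        e ℚ.* (ι (+ S n) ℚ.* ι B)       ≡⟨ id₁ e (ι (+ S n)) (ι B) ⟩
        ι (+ S n) ℚ.* (e ℚ.* ι B)       ≤⟨ ℚ.*-monoˡ-≤-nonNeg (ι (+ S n)) {{0≤ιS}} eB≤s ⟩
        ι (+ S n) ℚ.* ι (+ s)           ≡⟨ trans (cong ι (pos-* (S n) s)) (ι-* (+ S n) (+ s)) ⟨
        ι (+ (S n ℕ.* s))               ≤⟨ ι-mono-≤ {+ (S n ℕ.* s)} {+ (s ℕ.* s)} (+≤+ (ℕ.*-monoˡ-≤ s (gcd[m,n]≤n ∣ a n ∣ s))) ⟩
        ι (+ (s ℕ.* s))                 ∎
        where
        open ℚ.≤-Reasoning
        e = ℚ.∣ X ℚ.- Y ∣
        0≤ιS : ℚ.NonNegative (ι (+ S n))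
        0≤ιS = ℚ.nonNegative (ι-mono-≤ {0ℤ} {+ S n} (+≤+ ℕ.z≤n))
        id₁ : ∀ e S B → e ℚ.* (S ℚ.* B) ≡ S ℚ.* (e ℚ.* B)
        id₁ = ℚ-Solver.solve-∀ ℚ-ring
        id₂ : ∀ X Y W B → (X ℚ.- Y) ℚ.* (W ℚ.* B) ≡ X ℚ.* W ℚ.* B ℚ.- Y ℚ.* B ℚ.* W
        id₂ = ℚ-Solver.solve-∀ ℚ-ring
        difference : (X ℚ.- Y) ℚ.* ι (W * B) ≡ ι (- σ * q)
        difference = begin-equality
          (X ℚ.- Y) ℚ.* ι (W * B)               ≡⟨ cong ((X ℚ.- Y) ℚ.*_) (ι-* W B) ⟩
          (X ℚ.- Y) ℚ.* (ι W ℚ.* ι B)           ≡⟨ id₂ X Y (ι W) (ι B) ⟩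
          X ℚ.* ι W ℚ.* ι B ℚ.- Y ℚ.* ι B ℚ.* ι W ≡⟨ cong₂ (λ u t → u ℚ.* ι B ℚ.- t ℚ.* ι W) XW≡U YB≡T ⟩
          ι U ℚ.* ι B ℚ.- ι T ℚ.* ι W           ≡⟨ cong₂ ℚ._-_ (sym (ι-* U B)) (sym (ι-* T W)) ⟩
          ι (U * B) ℚ.- ι (T * W)               ≡⟨ ι-- (U * B) (T * W) ⟨
          ι (U * B - T * W)                     ≡⟨ cong ι UB-TW ⟩
          ι (- σ * q)                           ∎
        ∣-σq∣≡q : + ∣ - σ * q ∣ ≡ q
        ∣-σq∣≡q = trans (cong +_ (trans (∣i*j∣≡∣i∣*∣j∣ (- σ) q)
          (trans (cong (ℕ._* ∣ q ∣) (trans (∣-i∣≡∣i∣ σ) (∣sgn∣≡1 (D n)))) (ℕ.*-identityˡ ∣ q ∣))))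
          (0≤i⇒+∣i∣≡i (≤-trans 0≤1 1≤q))
        B≤∣WB∣ : B ≤ + ∣ W * B ∣
        B≤∣WB∣ = subst₂ _≤_ (0≤i⇒+∣i∣≡i 0≤B) (cong +_ (sym (∣i*j∣≡∣i∣*∣j∣ W B)))
          (+≤+ (ℕ.m≤n*m ∣ B ∣ ∣ W ∣ {{≢-nonZero W≢0}}))
        eB≤s : e ℚ.* ι B ℚ.≤ ι (+ s)
        eB≤s = begin
          e ℚ.* ι B                           ≤⟨ ℚ.*-monoˡ-≤-nonNeg e {{ℚ.∣-∣-nonNeg (X ℚ.- Y)}} (ι-mono-≤ {B} {+ ∣ W * B ∣} B≤∣WB∣) ⟩
          e ℚ.* ι (+ ∣ W * B ∣)               ≡⟨ cong (e ℚ.*_) (∣ι∣ (W * B)) ⟨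
          e ℚ.* ℚ.∣ ι (W * B) ∣               ≡⟨ ℚ.∣p*q∣≡∣p∣*∣q∣ (X ℚ.- Y) (ι (W * B)) ⟨
          ℚ.∣ (X ℚ.- Y) ℚ.* ι (W * B) ∣       ≡⟨ cong ℚ.∣_∣ difference ⟩
          ℚ.∣ ι (- σ * q) ∣                   ≡⟨ ∣ι∣ (- σ * q) ⟩
          ι (+ ∣ - σ * q ∣)                   ≡⟨ cong ι ∣-σq∣≡q ⟩
          ι q                                 ≤⟨ ι-mono-≤ {q} {+ s} q≤s ⟩
          ι (+ s)                             ∎

    d k : ℚ
    d = dVal s v m
    k = kVal s v m ε

    K : ℕ
    K = s ℕ.* s ℕ.* v

    svm kNum : ℤ
    svm = + (s ℕ.* v ℕ.* m)
    kNum = + (s ℕ.* s ℕ.* v) * (+ (v ℕ.* m ℕ.* m) + + 4 * ε)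

    svm≡ : ∀ n → svm ≡ + s * (V n * V (suc n)) * + m
    svm≡ n = trans (pos-* (s ℕ.* v) m) (cong (_* + m) (trans (pos-* s v) (cong (+ s *_) (sym (V-*-suc n)))))

    ssv≡ : ∀ n → + (s ℕ.* s ℕ.* v) ≡ + s * + s * (V n * V (suc n))
    ssv≡ n = trans (pos-* (s ℕ.* s) v) (cong₂ _*_ (pos-* s s) (sym (V-*-suc n)))

    -- This is 2 a_n (Y - d) with Y = z_n/a_n, where a_n is nonzero.
    2z-svm·a : ℕ → ℤ
    2z-svm·a n = + 2 * z n - svm * a n

    2z-svm·a-nonneg : ∀ n → 0ℤ ≤ 2z-svm·a n
    2z-svm·a-nonneg n = subst (0ℤ ≤_) (sym eq) (0≤+ s ⊗ 0≤+ (vSeq v (suc n)) ⊗ i≤j⇒0≤j-i (half n))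
      where
      id : ∀ s V₀ V₁ m a₁ a₀ → + 2 * (s * V₁ * a₁) - s * (V₀ * V₁) * m * a₀ ≡ s * V₁ * (+ 2 * a₁ - V₀ * m * a₀)
      id = solve-∀
      eq : 2z-svm·a n ≡ + s * V (suc n) * (+ 2 * a (suc n) - V n * + m * a n)
      eq = trans (cong (λ w → + 2 * z n - w * a n) (svm≡ n)) (id (+ s) (V n) (V (suc n)) (+ m) (a (suc n)) (a n))

    -- Since `kNum` is 4k, the left side is 4 a_n² ((Y - d)² - k) with Y = z_n/a_n; it is 4 s²
    -- v_{n+1} times the form evaluated by `pell`.
    discriminant : ∀ n → 2z-svm·a n * 2z-svm·a n - kNum * (a n * a n) ≡ + s * + s * V (suc n) * norm ε n * + 4
    discriminant n = begin
      2z-svm·a n * 2z-svm·a n - kNum * (a n * a n)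
        ≡⟨ cong₂ (λ u w → (+ 2 * z n - u * a n) * (+ 2 * z n - u * a n) - w * (a n * a n)) (svm≡ n)
             (cong₂ (λ u w → u * (w + + 4 * ε)) (ssv≡ n)
               (trans (pos-* (v ℕ.* m) m) (cong (_* + m) (trans (pos-* v m) (cong (_* + m) (sym (V-*-suc n))))))) ⟩
      (+ 2 * z n - + s * w * + m * a n) * (+ 2 * z n - + s * w * + m * a n) - + s * + s * w * (w * + m * + m + + 4 * ε) * (a n * a n)
        ≡⟨ id (+ s) (V n) (V (suc n)) (+ m) ε (a (suc n)) (a n) ⟩
      + s * + s * V (suc n) * (V (suc n) * (a (suc n) * a (suc n)) - w * + m * (a (suc n) * a n) - ε * V n * (a n * a n)) * + 4
        ≡⟨ cong (λ f → + s * + s * V (suc n) * f * + 4)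
             (trans (cong (λ w → V (suc n) * (a (suc n) * a (suc n)) - w * + m * (a (suc n) * a n) - ε * V n * (a n * a n)) (V-*-suc n)) (pell n)) ⟩
      + s * + s * V (suc n) * norm ε n * + 4 ∎
      where
      open ≡-Reasoning
      w = V n * V (suc n)
      id : ∀ s V₀ V₁ m ε a₁ a₀ →
        (+ 2 * (s * V₁ * a₁) - s * (V₀ * V₁) * m * a₀) * (+ 2 * (s * V₁ * a₁) - s * (V₀ * V₁) * m * a₀)
          - s * s * (V₀ * V₁) * (V₀ * V₁ * m * m + + 4 * ε) * (a₀ * a₀)
        ≡ s * s * V₁ * (V₁ * (a₁ * a₁) - V₀ * V₁ * m * (a₁ * a₀) - ε * V₀ * (a₀ * a₀)) * + 4
      id = solve-∀

    defect : ℕ → ℤ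
    defect n = + s * + s * V (suc n) * norm ε n

    ssV≤K : ∀ n → + s * + s * V (suc n) ≤ + K
    ssV≤K n = subst (+ s * + s * V (suc n) ≤_) (trans (id (+ s) (V n) (V (suc n))) (sym (ssv≡ n)))
      (≤-*ˡ (+≤+ (vSeq-pos 1≤v n)) (0≤+ s ⊗ 0≤+ s ⊗ 0≤+ (vSeq v (suc n))))
      where
      id : ∀ s V₀ V₁ → V₀ * (s * s * V₁) ≡ s * s * (V₀ * V₁)
      id = solve-∀

    defect-bounds : ∀ n → defect n ≤ + K × - defect n ≤ + K
    defect-bounds n = by-sign (norm-±1 ε≡±1 n)
      where
      x = + s * + s * V (suc n)
      -x≤K : - x ≤ + K
      -x≤K = ≤-trans (neg-mono-≤ {0ℤ} (0≤+ s ⊗ 0≤+ s ⊗ 0≤+ (vSeq v (suc n)))) (+≤+ ℕ.z≤n)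
      by-sign : ∀ {u} → u ≡ 1ℤ ⊎ u ≡ -1ℤ → x * u ≤ + K × - (x * u) ≤ + K
      by-sign (inj₁ refl) = subst (λ y → y ≤ + K × - y ≤ + K) (sym (*-identityʳ x)) (ssV≤K n , -x≤K)
      by-sign (inj₂ refl) = subst (_≤ + K) (id x) -x≤K , subst (_≤ + K) (id′ x) (ssV≤K n)
        where
        id : ∀ x → - x ≡ x * -1ℤ
        id = solve-∀
        id′ : ∀ x → x ≡ - (x * -1ℤ)
        id′ = solve-∀

    module Square (n : ℕ) {Y : ℚ} (YA≡Z : Y ℚ.* ι (a n) ≡ ι (z n)) where
      A c w : ℚ
      A = ι (a n)
      c = ι (+ 2)
      w = Y ℚ.- d

      d*2 : d ℚ.* c ≡ ι svm
      d*2 = /-*-cancel svm 2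

      k*4 : k ℚ.* (c ℚ.* c) ≡ ι kNum
      k*4 = /-*-cancel kNum 4

      w*2A : w ℚ.* (c ℚ.* A) ≡ ι (2z-svm·a n)
      w*2A = begin
        (Y ℚ.- d) ℚ.* (c ℚ.* A)             ≡⟨ id Y d c A ⟩
        c ℚ.* (Y ℚ.* A) ℚ.- d ℚ.* c ℚ.* A   ≡⟨ cong₂ (λ u t → c ℚ.* u ℚ.- t ℚ.* A) YA≡Z d*2 ⟩
        c ℚ.* ι (z n) ℚ.- ι svm ℚ.* A       ≡⟨ cong₂ ℚ._-_ (sym (ι-* (+ 2) (z n))) (sym (ι-* svm (a n))) ⟩
        ι (+ 2 * z n) ℚ.- ι (svm * a n)     ≡⟨ ι-- (+ 2 * z n) (svm * a n) ⟨
        ι (2z-svm·a n)                      ∎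
        where
        open ≡-Reasoning
        id : ∀ Y d c A → (Y ℚ.- d) ℚ.* (c ℚ.* A) ≡ c ℚ.* (Y ℚ.* A) ℚ.- d ℚ.* c ℚ.* A
        id = ℚ-Solver.solve-∀ ℚ-ring

      w²-k : (w ℚ.* w ℚ.- k) ℚ.* (A ℚ.* A) ≡ ι (defect n)
      w²-k = *-cancelʳ-≢0 (c ℚ.* c) (λ ()) (begin
        (w ℚ.* w ℚ.- k) ℚ.* (A ℚ.* A) ℚ.* (c ℚ.* c)
          ≡⟨ id w k A c ⟩
        w ℚ.* (c ℚ.* A) ℚ.* (w ℚ.* (c ℚ.* A)) ℚ.- k ℚ.* (c ℚ.* c) ℚ.* (A ℚ.* A)
          ≡⟨ cong₂ (λ x y → x ℚ.* x ℚ.- y ℚ.* (A ℚ.* A)) w*2A k*4 ⟩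
        ι (2z-svm·a n) ℚ.* ι (2z-svm·a n) ℚ.- ι kNum ℚ.* (A ℚ.* A)
          ≡⟨ cong₂ ℚ._-_ (sym (ι-* (2z-svm·a n) (2z-svm·a n)))
               (trans (cong (ι kNum ℚ.*_) (sym (ι-* (a n) (a n)))) (sym (ι-* kNum (a n * a n)))) ⟩
        ι (2z-svm·a n * 2z-svm·a n) ℚ.- ι (kNum * (a n * a n))
          ≡⟨ ι-- (2z-svm·a n * 2z-svm·a n) (kNum * (a n * a n)) ⟨
        ι (2z-svm·a n * 2z-svm·a n - kNum * (a n * a n))
          ≡⟨ cong ι (discriminant n) ⟩
        ι (defect n * + 4)
          ≡⟨ ι-* (defect n) (+ 4) ⟩
        ι (defect n) ℚ.* (c ℚ.* c) ∎)
        where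
        open ≡-Reasoning
        id : ∀ w k A c → (w ℚ.* w ℚ.- k) ℚ.* (A ℚ.* A) ℚ.* (c ℚ.* c) ≡
          w ℚ.* (c ℚ.* A) ℚ.* (w ℚ.* (c ℚ.* A)) ℚ.- k ℚ.* (c ℚ.* c) ℚ.* (A ℚ.* A)
        id = ℚ-Solver.solve-∀ ℚ-ring

      module _ (0<a : 0ℤ < a n) where

        0<A : 0ℚ ℚ.< A
        0<A = ι-mono-< {0ℤ} {a n} 0<a

        instance
          A-pos : ℚ.Positive A
          A-pos = ℚ.positive 0<A

          A²-nonNeg : ℚ.NonNegative (A ℚ.* A)
          A²-nonNeg = ℚ.pos⇒nonNeg (A ℚ.* A) {{ℚ.pos*pos⇒pos A A}}

          cA-pos : ℚ.Positive (c ℚ.* A)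
          cA-pos = ℚ.pos*pos⇒pos c A

        w-nonneg : 0ℚ ℚ.≤ w
        w-nonneg = ℚ.*-cancelʳ-≤-pos (c ℚ.* A) (subst₂ ℚ._≤_ (sym (ℚ.*-zeroˡ (c ℚ.* A))) (sym w*2A)
          (ι-mono-≤ {0ℤ} {2z-svm·a n} (2z-svm·a-nonneg n)))

        module _ {ρ : ℚ} (K<Aρ : ι (+ K) ℚ.< A ℚ.* ρ) where

          -- K ≥ 1 gives K ≤ K², so the single threshold K < a_n ρ controls both the linear error in
          -- `distance` and the quadratic one here.
          K<[Aρ]² : ι (+ K) ℚ.< ρ ℚ.* ρ ℚ.* (A ℚ.* A)
          K<[Aρ]² = begin-strict
            ι (+ K)                        ≤⟨ ι-mono-≤ {+ K} {+ K * + K} (≤-*ˡ 1≤K (+≤+ ℕ.z≤n)) ⟩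
            ι (+ K * + K)                  ≡⟨ ι-* (+ K) (+ K) ⟩
            ι (+ K) ℚ.* ι (+ K)            ≤⟨ ℚ.*-monoˡ-≤-nonNeg (ι (+ K)) {{ℚ.nonNegative 0≤ιK}} (ℚ.<⇒≤ K<Aρ) ⟩
            ι (+ K) ℚ.* (A ℚ.* ρ)          <⟨ ℚ.*-monoˡ-<-pos (A ℚ.* ρ) {{ℚ.positive (ℚ.≤-<-trans 0≤ιK K<Aρ)}} K<Aρ ⟩
            A ℚ.* ρ ℚ.* (A ℚ.* ρ)          ≡⟨ id A ρ ⟩
            ρ ℚ.* ρ ℚ.* (A ℚ.* A)          ∎
            where
            open ℚ.≤-Reasoning
            1≤K : 1ℤ ≤ + K
            1≤K = +≤+ (ℕ.*-mono-≤ (ℕ.*-mono-≤ 1≤s 1≤s) 1≤v)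
            0≤ιK : 0ℚ ℚ.≤ ι (+ K)
            0≤ιK = ι-mono-≤ {0ℤ} {+ K} (+≤+ ℕ.z≤n)
            id : ∀ A ρ → A ℚ.* ρ ℚ.* (A ℚ.* ρ) ≡ ρ ℚ.* ρ ℚ.* (A ℚ.* A)
            id = ℚ-Solver.solve-∀ ℚ-ring

          w²-k<ρ² : w ℚ.* w ℚ.- k ℚ.< ρ ℚ.* ρ
          w²-k<ρ² = ℚ.*-cancelʳ-<-nonNeg (A ℚ.* A) (subst (ℚ._< ρ ℚ.* ρ ℚ.* (A ℚ.* A)) (sym w²-k)
            (ℚ.≤-<-trans (ι-mono-≤ {defect n} {+ K} (proj₁ (defect-bounds n))) K<[Aρ]²))

          k-w²<ρ² : k ℚ.- w ℚ.* w ℚ.< ρ ℚ.* ρ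
          k-w²<ρ² = ℚ.*-cancelʳ-<-nonNeg (A ℚ.* A) (subst (ℚ._< ρ ℚ.* ρ ℚ.* (A ℚ.* A)) (sym eq)
            (ℚ.≤-<-trans (ι-mono-≤ { - defect n} {+ K} (proj₂ (defect-bounds n))) K<[Aρ]²))
            where
            id : ∀ x k A → (k ℚ.- x) ℚ.* A ≡ 0ℚ ℚ.- (x ℚ.- k) ℚ.* A
            id = ℚ-Solver.solve-∀ ℚ-ring
            eq : (k ℚ.- w ℚ.* w) ℚ.* (A ℚ.* A) ≡ ι (- defect n)
            eq = trans (id (w ℚ.* w) k (A ℚ.* A)) (trans (cong (λ x → 0ℚ ℚ.- x) w²-k)
              (trans (sym (ι-- 0ℤ (defect n))) (cong ι (+-identityˡ (- defect n)))))

    nonempty : ∀ n → 1 ℕ.≤ length (E n)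
    nonempty n = IsCFExpansion⇒nonempty (E n) (proj₁ (isblocks n))

    open Truncation E nonempty

    prefix-close : ∀ {ρ} → 0ℚ ℚ.< ρ → ∀ n k′ → + (s ℕ.* s) < a n → ι (+ K) ℚ.< ι (a n) ℚ.* ρ →
      Σ ℚ λ q → cf (D n ++ take (suc k′) (E n)) ≡ fin q × CloseToXi s v m ε (ρ ℚ.+ ρ) q
    prefix-close {ρ} 0<ρ n k′ s²<a K<Aρ = near
      (Rep-finite (Rep-cf (D n ++ take (suc k′) (E n))) (Prefix.W≢0 n k′ (s<den n s²<a)))
      (Rep-finite (Rep-cf (D n)) (Prefix.B≢0 n k′ (s<den n s²<a)))
      where
      open Prefix n k′ (s<den n s²<a) using (T; B; U; W; distance)
      0<a : 0ℤ < a n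
      0<a = ≤-<-trans (+≤+ ℕ.z≤n) s²<a
      A : ℚ
      A = ι (a n)
      scaled : ∀ {Y} → Y ℚ.* ι B ≡ ι T → Y ℚ.* A ≡ ι (z n)
      scaled {Y} YB≡T = begin
        Y ℚ.* A                         ≡⟨ cong (λ i → Y ℚ.* ι i) (Row.first (Rows.bottom (rows n))) ⟨
        Y ℚ.* ι (+ S n * B)             ≡⟨ cong (Y ℚ.*_) (ι-* (+ S n) B) ⟩
        Y ℚ.* (ι (+ S n) ℚ.* ι B)       ≡⟨ id Y (ι (+ S n)) (ι B) ⟩
        ι (+ S n) ℚ.* (Y ℚ.* ι B)       ≡⟨ cong (ι (+ S n) ℚ.*_) YB≡T ⟩
        ι (+ S n) ℚ.* ι T               ≡⟨ ι-* (+ S n) T ⟨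
        ι (+ S n * T)                   ≡⟨ cong ι (Row.first (Rows.top (rows n))) ⟩
        ι (z n)                         ∎
        where
        open ≡-Reasoning
        id : ∀ x y z → x ℚ.* (y ℚ.* z) ≡ y ℚ.* (x ℚ.* z)
        id = ℚ-Solver.solve-∀ ℚ-ring
      within : ∀ {X Y} → X ℚ.* ι W ≡ ι U → Y ℚ.* ι B ≡ ι T → ℚ.∣ X ℚ.- Y ∣ ℚ.< ρ
      within {X} {Y} XW≡U YB≡T = ℚ.*-cancelʳ-<-nonNeg A {{ℚ.nonNegative (ι-mono-≤ {0ℤ} {a n} (<⇒≤ 0<a))}} (begin-strict
        ℚ.∣ X ℚ.- Y ∣ ℚ.* A         ≤⟨ distance {X} {Y} XW≡U YB≡T ⟩
        ι (+ (s ℕ.* s))             ≤⟨ ι-mono-≤ {+ (s ℕ.* s)} {+ K} (+≤+ (ℕ.m≤m*n (s ℕ.* s) v {{ℕ.>-nonZero 1≤v}})) ⟩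
        ι (+ K)                     <⟨ K<Aρ ⟩
        A ℚ.* ρ                     ≡⟨ ℚ.*-comm A ρ ⟩
        ρ ℚ.* A                     ∎)
        where open ℚ.≤-Reasoning
      near : (∃ λ X → cf (D n ++ take (suc k′) (E n)) ≡ fin X × X ℚ.* ι W ≡ ι U) →
        (∃ λ Y → cf (D n) ≡ fin Y × Y ℚ.* ι B ≡ ι T) →
        Σ ℚ λ q → cf (D n ++ take (suc k′) (E n)) ≡ fin q × CloseToXi s v m ε (ρ ℚ.+ ρ) q
      near (X , cf≡X , XW≡U) (Y , _ , YB≡T) = X , cf≡X ,
        sqrt-window {X} {Y} {d} {k} {ρ} (ℚ.<⇒≤ 0<ρ) (w-nonneg 0<a) (ℚ.<⇒≤ (within {X} {Y} XW≡U YB≡T))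
          (w²-k<ρ² 0<a K<Aρ) (k-w²<ρ² 0<a K<Aρ)
        where open Square n {Y} (scaled {Y} YB≡T)

    converges : TendsToXi s v m ε (truncation E)
    converges r 0<r = length (blocks E n₀) , λ j n₀≤j → close-at j (truncation-split n₀ j n₀≤j)
      where
      ρ : ℚ
      ρ = ℚ.½ ℚ.* r
      0<ρ : 0ℚ ℚ.< ρ
      0<ρ = ℚ.positive⁻¹ ρ {{ℚ.pos*pos⇒pos ℚ.½ r {{ℚ.positive 0<r}}}}
      threshold : ∃ λ (N : ℕ) → ∀ {i} → + N ≤ i → ι (+ K) ℚ.< ι i ℚ.* ρ
      threshold = archimedean 0<ρ K
      N₀ N₁ n₀ : ℕ
      N₀ = proj₁ threshold
      -- a_n ≥ N₀ makes a_n ρ exceed `K`, and a_n > s² keeps the denominators nonzero. The index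
      -- bound is twice `N₁` because `n≤2a` only gives a_n ≥ n/2.
      N₁ = N₀ ℕ.+ suc (s ℕ.* s)
      n₀ = 2 ℕ.* N₁
      halves : ρ ℚ.+ ρ ≡ r
      halves = trans (sym (ℚ.*-distribʳ-+ r ℚ.½ ℚ.½)) (ℚ.*-identityˡ r)
      N₁≤a : ∀ {n} → n₀ ℕ.≤ n → + N₁ ≤ a n
      N₁≤a {n} n₀≤n = *-cancelˡ-≤-pos (+ N₁) (a n) (+ 2)
        (≤-trans (≤-reflexive (sym (pos-* 2 N₁))) (≤-trans (+≤+ n₀≤n) (n≤2a n)))
      close-at : ∀ j → (∃ λ n → ∃ λ k′ → n₀ ℕ.≤ n × map (cTerm E) (upTo (suc j)) ≡ blocks E n ++ take (suc k′) (E n)) →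
        Σ ℚ λ q → truncation E j ≡ fin q × CloseToXi s v m ε r q
      close-at j (n , k′ , n₀≤n , eq) =
        q , trans (cong cf eq) cf≡q , subst (λ x → CloseToXi s v m ε x q) halves near
        where
        nearby = prefix-close 0<ρ n k′
          (<-≤-trans (+<+ (ℕ.m≤n+m (suc (s ℕ.* s)) N₀)) (N₁≤a n₀≤n))
          (proj₂ threshold (≤-trans (+≤+ (ℕ.m≤m+n N₀ (suc (s ℕ.* s)))) (N₁≤a n₀≤n)))
        q = proj₁ nearby
        cf≡q = proj₁ (proj₂ nearby)
        near = proj₂ (proj₂ nearby)

open import Data.Nat using (_*_; _^_; _≤_)

theorem3p3 : (s v m : ℕ) (ε : ℤ) →
    1 ≤ s → 1 ≤ v → 1 ≤ m →
    (ε ≡ 1ℤ ⊎ ε ≡ -1ℤ) →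
    ¬ (ε ≡ -1ℤ × v * m ^ 2 ≤ 4) →
    (mseq : ℕ → ℤ) → IsMSeq s v m ε mseq →
    (E : ℕ → List ℤ) → IsBlocks s v m ε mseq E →
    TendsToXi s v m ε (truncation E) ×
    (∀ n → cf (blocks E n) ≡ iter (fXi s v m ε) n ∞)
theorem3p3 s v m ε 1≤s 1≤v 1≤m ε≡±1 large mseq ismseq E isblocks =
  Limit.Convergence.converges s v m ε 1≤s 1≤v ε≡±1 grow ismseq isblocks ,
  BlockMatrices.Blocks.cf-blocks s v m ε 1≤s 1≤v ε≡±1 grow ismseq isblocks
  where grow = Recurrence.growth 1≤v 1≤m ε≡±1 large
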